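{- Let $N\ge1$ be an integer and assume the prime $2N$-tuplets conjecture TC($2N$). Let $s\ge 1$ and let $g_1,\dots,g_s$ be integers different from $-1,0,1$. Suppose that for every choice of $e_1,\dots,e_s\in\{0,1\}$ with $e_1+\dots+e_s$ odd, the product $\prod_{i=1}^s g_i^{e_i}$ is not a perfect square. Suppose furthermore that for each $i$ the discriminant of the field $\mathbb Q(\sqrt{g_i})$ is not divisible by $3$. Then there exist integers $A$ and $C$ such that $p(j)=Aj^2+C$ is prime for $1\le j\le N$ and each of $g_1,\dots,g_s$ is a primitive root modulo $p(j)$ for every $1\le j\le N$.
   Context: TC($k$) is the statement: for all integers $A_1,\dots,A_k,B_1,\dots,B_k$ with $A_j>0$ such that for every prime $p$ there is an integer $n_p$ with $p\nmid\prod_{j=1}^k(A_jn_p+B_j)$, there exist infinitely many integers $n$ such that $A_jn+B_j$ is prime for all $1\le j\le k$. -}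

module Defs where

open import Data.Nat as ℕ using (ℕ; zero; suc)
open import Data.Nat.Primality using (Prime)
open import Data.Integer as ℤ using (ℤ; +_; -[1+_]; ∣_∣)
open import Data.Integer.Divisibility using (_∣_)
open import Data.Nat.Divisibility using () renaming (_∣_ to _ℕ∣_)
open import Data.Fin using (Fin; zero; suc; toℕ)
open import Data.Product using (Σ; ∃; _×_; _,_)
open import Relation.Binary.PropositionalEquality using (_≡_)
open import Relation.Nullary using (¬_)

∏ℤ : (k : ℕ) → (Fin k → ℤ) → ℤ
∏ℤ zero f = + 1
∏ℤ (suc k) f = f zero ℤ.* ∏ℤ k (λ i → f (suc i))

∑ℕ : (k : ℕ) → (Fin k → ℕ) → ℕ
∑ℕ zero f = 0
∑ℕ (suc k) f = f zero ℕ.+ ∑ℕ k (λ i → f (suc i))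

IsPrimeℤ : ℤ → Set
IsPrimeℤ x = Σ ℕ λ q → (x ≡ + q) × Prime q

CongMod : ℕ → ℤ → ℤ → Set
CongMod m a b = (+ m) ∣ (a ℤ.- b)

TC : ℕ → Set
TC k =
  (A B : Fin k → ℤ) →
  (∀ j → ℤ.0ℤ ℤ.< A j) →
  (∀ (p : ℕ) → Prime p → Σ ℤ λ n → ¬ ((+ p) ∣ ∏ℤ k (λ j → A j ℤ.* n ℤ.+ B j))) →
  ∀ (M : ℕ) → Σ ℤ λ n → (M ℕ.< ∣ n ∣) × (∀ j → IsPrimeℤ (A j ℤ.* n ℤ.+ B j))

IsSquare : ℤ → Set
IsSquare x = Σ ℤ λ m → x ≡ m ℤ.* m

SquareFree : ℤ → Set
SquareFree d = ∀ (m : ℕ) → (m ℕ.* m) ℕ∣ ∣ d ∣ → m ≡ 1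

-- discriminant of a quadratic field Q(√d), d squarefree:
-- d if d ≡ 1 (mod 4), 4d otherwise
quadDisc : ℤ → ℤ
quadDisc d with ∣ d ℤ.- + 1 ∣ ℕ.% 4
... | zero = d
... | suc _ = + 4 ℤ.* d

IsDiscOfQSqrt : ℤ → ℤ → Set
IsDiscOfQSqrt g D =
  Σ ℤ λ f → Σ ℤ λ d → (g ≡ f ℤ.* f ℤ.* d) × SquareFree d × (D ≡ quadDisc d)

IsPrimitiveRoot : ℤ → ℕ → Set
IsPrimitiveRoot g p =
  ¬ ((+ p) ∣ g) ×
  CongMod p (g ℤ.^ (p ℕ.∸ 1)) (+ 1) ×
  (∀ (k : ℕ) → 1 ℕ.≤ k → k ℕ.< p ℕ.∸ 1 → ¬ CongMod p (g ℤ.^ k) (+ 1))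

{-# OPTIONS --safe #-}

-- Choose a residue class c mod M such that every prime p ≡ c (mod M) has all the g i as
-- quadratic nonresidues, and then use TC to make p = 1 + 2 ^ k q with q prime (k = 1, 2 or 3)
-- for the N values p = M (n + j²) + c.  For such a p, a nonresidue g of absolute value at
-- least 2 is a primitive root as soon as p > |g| ^ 2 ^ k.
-- Up to squares g i is a product of -1 and primes other than 3, so the class is found by
-- prescribing the quadratic characters of -1 and of these primes.  Over 𝔽₂ this is a linear
-- system, solvable by the Fredholm alternative: an obstruction is a product of an odd number
-- of the g i that is a square.  By reciprocity, prescribing (l | p) amounts to prescribing
-- the residue or nonresidue class of c mod l; since l ≥ 5, c can moreover avoid 0 and 1
-- there, and c ≡ 2 does so modulo 3.  This leaves both p and q prime to l, which makes the
-- linear forms of p and q admissible for TC.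
module Submission where

open import Defs
open import Data.Nat as ℕ using (ℕ; zero; suc; parity; _+_; _*_; _∸_; _<_; _≤_; z≤n; s≤s; NonZero)
import Data.Nat.Properties as ℕ
import Data.Nat.Divisibility as ℕD
open import Data.Nat.Induction using (<-rec)
open import Data.Nat.ListAction using (product)
open import Data.Nat.Primality.Factorisation using (factorise)
open import Data.List.Relation.Unary.All using (All; []; _∷_)
open import Data.Nat.Divisibility using () renaming (_∣_ to _ℕ∣_; divides to ℕdivides)
open import Data.Nat.DivMod using ([m+n]%n≡m%n; m/n*n≤m; m*n/n≡m; /-monoˡ-≤; m<n*o⇒m/o<n; m<n⇒m/n≡0; _/_; _%_; m≡m%n+[m/n]*n; m%n<n)
open import Data.Nat.Primality using (productOfPrimes≢0; Prime; prime?; euclidsLemma; prime⇒nonZero; prime⇒irreducible; prime[2]; ¬prime[0]; ¬prime[1])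
open import Data.Nat.Coprimality as Coprimality using (Coprime; coprime-Bézout; coprime-divisor)
open import Data.Nat.GCD using (gcd; GCD; gcd-GCD; gcd[m,n]∣m; gcd[m,n]∣n; module Bézout)
open import Data.Integer as ℤ using (ℤ; +_; -[1+_]; ∣_∣)
import Data.Integer.Properties as ℤ
open import Data.Integer.DivMod using (_%ℕ_; _/ℕ_; a≡a%ℕn+[a/ℕn]*n)
open import Data.Integer.Divisibility using (_∣_)
import Data.Integer.Divisibility.Signed as Signed
open import Data.Integer.Tactic.RingSolver using (solve-∀)
import Data.Nat.Tactic.RingSolver as ℕSolver
open import Data.Parity as ℙ using (Parity; 0ℙ; 1ℙ)
import Data.Parity.Properties as ℙ
open import Data.Fin using (Fin; zero; suc; toℕ; fromℕ<)
import Data.Fin as Fin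
import Data.Fin.Properties as Fin
open import Data.Fin.Permutation using (Permutation′; permutation)
open import Data.List using ([]; _∷_)
open import Data.Vec using (Vec; []; _∷_; replicate)
open import Data.Product using (Σ; ∃₂; _×_; _,_; proj₁; proj₂)
open import Data.Sum using (_⊎_; inj₁; inj₂; [_,_]′)
open import Data.Empty using (⊥; ⊥-elim)
open import Function using (_∘_; id)
open import Relation.Binary.Bundles using (Setoid)
open import Relation.Binary.PropositionalEquality using (_≡_; _≢_; refl; sym; trans; cong; cong₂; subst; module ≡-Reasoning)
import Relation.Binary.Reasoning.Setoid as SetoidReasoning
open import Relation.Nullary using (¬_; Dec; yes; no; contradiction)
import Relation.Nullary.Decidable as Dec
import Algebra.Properties.CommutativeMonoid.Sum as CMSum
import Algebra.Properties.Semiring.Sum as SRSum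

-- The class of p has to avoid 0 modulo every small odd prime l, since p is prime, and also 1, since
-- otherwise l divides p - 1 and hence q. Modulo 3 only 2 remains, and reciprocity then gives (3 |
-- p) = -(-1 | p), so this character cannot be prescribed. The hypothesis on the discriminants keeps
-- 3 out of the square-free parts of the `g i`, and the question does not arise. The prime 2 decides
-- the range of k. If -1 and 2 must both be residues, then p ≡ 1 modulo 8, and neither 1 + 2 q nor 1
-- + 4 q with q odd is possible. The class 9 modulo 16 makes p - 1 an odd multiple of 8.

module ∑ℙ = SRSum ℙ.+-*-semiring
module ∏ = CMSum ℤ.*-1-commutativeMonoid

-- Congruences between integers

infix 4 _≋_[mod_]

-- Keeping the integer quotient as data lets a proof match the equality with `refl`, after which
-- sums and products of congruences are ring identities. The divisibility of absolute values in
-- `CongMod` hides the sign of the quotient.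
record _≋_[mod_] (a b : ℤ) (m : ℕ) : Set where
  constructor congruent
  field
    quotient : ℤ
    equality : a ≡ b ℤ.+ quotient ℤ.* + m

≋-refl : ∀ {m a} → a ≋ a [mod m ]
≋-refl {a = a} = congruent (+ 0) (sym (ℤ.+-identityʳ a))

≋-reflexive : ∀ {m a b} → a ≡ b → a ≋ b [mod m ]
≋-reflexive refl = ≋-refl

≋-sym : ∀ {m a b} → a ≋ b [mod m ] → b ≋ a [mod m ]
≋-sym {m} {_} {b} (congruent q refl) = congruent (ℤ.- q) (lemma b q (+ m))
  where
  lemma : ∀ b q m → b ≡ b ℤ.+ q ℤ.* m ℤ.+ (ℤ.- q) ℤ.* m
  lemma = solve-∀

≋-trans : ∀ {m a b c} → a ≋ b [mod m ] → b ≋ c [mod m ] → a ≋ c [mod m ]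
≋-trans {m} {_} {_} {c} (congruent q refl) (congruent r refl) = congruent (r ℤ.+ q) (lemma c q r (+ m))
  where
  lemma : ∀ c q r m → c ℤ.+ r ℤ.* m ℤ.+ q ℤ.* m ≡ c ℤ.+ (r ℤ.+ q) ℤ.* m
  lemma = solve-∀

≋-setoid : ℕ → Setoid _ _
≋-setoid m = record
  { _≈_ = λ a b → a ≋ b [mod m ]
  ; isEquivalence = record { refl = ≋-refl ; sym = ≋-sym ; trans = ≋-trans }
  }

module ≋-Reasoning (m : ℕ) = SetoidReasoning (≋-setoid m)

≋-+ : ∀ {m a b c d} → a ≋ b [mod m ] → c ≋ d [mod m ] → a ℤ.+ c ≋ b ℤ.+ d [mod m ]
≋-+ {m} {_} {b} {_} {d} (congruent q refl) (congruent r refl) = congruent (q ℤ.+ r) (lemma b d q r (+ m))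
  where
  lemma : ∀ b d q r m → (b ℤ.+ q ℤ.* m) ℤ.+ (d ℤ.+ r ℤ.* m) ≡ b ℤ.+ d ℤ.+ (q ℤ.+ r) ℤ.* m
  lemma = solve-∀

≋-* : ∀ {m a b c d} → a ≋ b [mod m ] → c ≋ d [mod m ] → a ℤ.* c ≋ b ℤ.* d [mod m ]
≋-* {m} {_} {b} {_} {d} (congruent q refl) (congruent r refl) =
  congruent (q ℤ.* d ℤ.+ r ℤ.* b ℤ.+ q ℤ.* r ℤ.* + m) (lemma b d q r (+ m))
  where
  lemma : ∀ b d q r m → (b ℤ.+ q ℤ.* m) ℤ.* (d ℤ.+ r ℤ.* m) ≡ b ℤ.* d ℤ.+ (q ℤ.* d ℤ.+ r ℤ.* b ℤ.+ q ℤ.* r ℤ.* m) ℤ.* m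
  lemma = solve-∀

≋-neg : ∀ {m a b} → a ≋ b [mod m ] → ℤ.- a ≋ ℤ.- b [mod m ]
≋-neg {m} {_} {b} (congruent q refl) = congruent (ℤ.- q) (lemma b q (+ m))
  where
  lemma : ∀ b q m → ℤ.- (b ℤ.+ q ℤ.* m) ≡ ℤ.- b ℤ.+ (ℤ.- q) ℤ.* m
  lemma = solve-∀

≋-^ : ∀ {m a b} k → a ≋ b [mod m ] → a ℤ.^ k ≋ b ℤ.^ k [mod m ]
≋-^ zero    _ = ≋-refl
≋-^ (suc k) e = ≋-* e (≋-^ k e)

≋-∏ : ∀ {m n} {f g : Fin n → ℤ} → (∀ i → f i ≋ g i [mod m ]) → ∏.sum f ≋ ∏.sum g [mod m ]
≋-∏ {n = zero}  e = ≋-refl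
≋-∏ {n = suc n} e = ≋-* (e zero) (≋-∏ (e ∘ suc))

≋-∣ : ∀ {m n a b} → m ℕ∣ n → a ≋ b [mod n ] → a ≋ b [mod m ]
≋-∣ {m} {_} {_} {b} (ℕdivides d refl) (congruent q refl) =
  congruent (q ℤ.* + d) (cong (λ z → b ℤ.+ z) (trans (cong (q ℤ.*_) (ℤ.pos-* d m)) (sym (ℤ.*-assoc q (+ d) (+ m)))))

m≋0 : ∀ {m} → + m ≋ + 0 [mod m ]
m≋0 {m} = congruent (+ 1) (sym (trans (ℤ.+-identityˡ _) (ℤ.*-identityˡ (+ m))))

∣⇒≋0 : ∀ {m a} → (+ m) ∣ a → a ≋ + 0 [mod m ]
∣⇒≋0 {m} {a} m∣a with Signed.divides q eq ← Signed.∣ᵤ⇒∣ {+ m} {a} m∣a = congruent q (trans eq (sym (ℤ.+-identityˡ _)))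

≋0⇒∣ : ∀ {m a} → a ≋ + 0 [mod m ] → (+ m) ∣ a
≋0⇒∣ {m} {a} (congruent q eq) = Signed.∣⇒∣ᵤ {+ m} {a} (Signed.divides q (trans eq (ℤ.+-identityˡ _)))

≋⇒-≋0 : ∀ {m a b} → a ≋ b [mod m ] → a ℤ.- b ≋ + 0 [mod m ]
≋⇒-≋0 {b = b} e = ≋-trans (≋-+ e ≋-refl) (≋-reflexive (ℤ.+-inverseʳ b))

-≋0⇒≋ : ∀ {m a b} → a ℤ.- b ≋ + 0 [mod m ] → a ≋ b [mod m ]
-≋0⇒≋ {m} {a} {b} e = ≋-trans (≋-reflexive (lemma a b)) (≋-trans (≋-+ e ≋-refl) (≋-reflexive (ℤ.+-identityˡ b)))
  where
  lemma : ∀ a b → a ≡ a ℤ.- b ℤ.+ b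
  lemma = solve-∀

≋⇒CongMod : ∀ {m a b} → a ≋ b [mod m ] → CongMod m a b
≋⇒CongMod e = ≋0⇒∣ (≋⇒-≋0 e)

CongMod⇒≋ : ∀ {m a b} → CongMod m a b → a ≋ b [mod m ]
CongMod⇒≋ {m} {a} {b} d = -≋0⇒≋ (∣⇒≋0 {m} {a ℤ.- b} d)

≋0-small : ∀ {m n} → + n ≋ + 0 [mod m ] → n < m → n ≡ 0
≋0-small {m} {zero}  e n<m = refl
≋0-small {m} {suc n} e n<m = contradiction (ℕD.∣⇒≤ (≋0⇒∣ e)) (ℕ.<⇒≱ n<m)

≋-small : ∀ {m a b} → + a ≋ + b [mod m ] → a < m → b < m → a ≡ b
≋-small {m} {a} {b} e a<m b<m = [ (λ a≤b → sym (go a≤b b<m (≋-sym e))) , (λ b≤a → go b≤a a<m e) ]′ (ℕ.≤-total a b)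
  where
  go : ∀ {x y} → x ≤ y → y < m → + y ≋ + x [mod m ] → y ≡ x
  go {x} {y} x≤y y<m e = ℕ.≤-antisym (ℕ.m∸n≡0⇒m≤n (≋0-small e′ (ℕ.≤-<-trans (ℕ.m∸n≤m y x) y<m))) x≤y
    where
    e′ : + (y ∸ x) ≋ + 0 [mod m ]
    e′ = ≋-trans (≋-reflexive (trans (sym (ℤ.⊖-≥ x≤y)) (sym (ℤ.m-n≡m⊖n y x)))) (≋⇒-≋0 e)

≋-% : ∀ n m .{{_ : NonZero m}} → + n ≋ + (n % m) [mod m ]
≋-% n m = congruent (+ (n / m))
  (trans (cong +_ (m≡m%n+[m/n]*n n m)) (cong (λ z → + (n % m) ℤ.+ z) (ℤ.pos-* (n / m) m)))

prime-∣* : ∀ {p} → Prime p → ∀ {a b} → a ℤ.* b ≋ + 0 [mod p ] → (a ≋ + 0 [mod p ]) ⊎ (b ≋ + 0 [mod p ])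
prime-∣* pr {a} {b} e =
  [ (λ d → inj₁ (∣⇒≋0 {a = a} d)) , (λ d → inj₂ (∣⇒≋0 {a = b} d)) ]′ (euclidsLemma ∣ a ∣ ∣ b ∣ pr (subst (_ ℕ∣_) (ℤ.abs-* a b) (≋0⇒∣ e)))

*-cancelˡ-≋ : ∀ {p} → Prime p → ∀ {a b c} → ¬ (c ≋ + 0 [mod p ]) → c ℤ.* a ≋ c ℤ.* b [mod p ] → a ≋ b [mod p ]
*-cancelˡ-≋ pr {a} {b} {c} c≢0 e =
  [ (λ c≋0 → contradiction c≋0 c≢0) , -≋0⇒≋ ]′
    (prime-∣* pr (≋-trans (≋-reflexive (lemma a b c)) (≋⇒-≋0 e)))
  where
  lemma : ∀ a b c → c ℤ.* (a ℤ.- b) ≡ c ℤ.* a ℤ.- c ℤ.* b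
  lemma = solve-∀

1≋̸0 : ∀ {p} → Prime p → ¬ (+ 1 ≋ + 0 [mod p ])
1≋̸0 pr e = contradiction (subst Prime (ℕD.∣1⇒≡1 (≋0⇒∣ e)) pr) ¬prime[1]

coprime⇒inverse : ∀ {m a} → Coprime m a → Σ ℤ λ b → + a ℤ.* b ≋ + 1 [mod m ]
coprime⇒inverse {m} {a} co with coprime-Bézout co
... | Bézout.+- x y eq = ℤ.- + y , congruent (ℤ.- + x) (begin
    + a ℤ.* ℤ.- + y                                           ≡⟨ lemma (+ a) (+ y) (+ 1) ⟩
    + 1 ℤ.- (+ 1 ℤ.+ + y ℤ.* + a)                             ≡⟨ cong (λ z → + 1 ℤ.- z) (trans (cong (λ z → + 1 ℤ.+ z) (sym (ℤ.pos-* y a))) (trans (cong +_ eq) (ℤ.pos-* x m))) ⟩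
    + 1 ℤ.- + x ℤ.* + m                                       ≡⟨ cong (λ z → + 1 ℤ.+ z) (ℤ.neg-distribˡ-* (+ x) (+ m)) ⟩
    + 1 ℤ.+ (ℤ.- + x) ℤ.* + m                                 ∎)
  where
  open ≡-Reasoning
  lemma : ∀ a y o → a ℤ.* ℤ.- y ≡ o ℤ.- (o ℤ.+ y ℤ.* a)
  lemma = solve-∀
... | Bézout.-+ x y eq = + y , congruent (+ x) (trans (ℤ.*-comm (+ a) (+ y)) (trans (sym (ℤ.pos-* y a))
        (trans (cong +_ (sym eq)) (cong (λ z → + 1 ℤ.+ z) (ℤ.pos-* x m)))))

prime-coprime : ∀ {p a} → Prime p → ¬ (p ℕ∣ a) → Coprime p a
prime-coprime pr p∤a (d∣p , d∣a) with prime⇒irreducible pr d∣p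
... | inj₁ d≡1  = d≡1
... | inj₂ refl = contradiction d∣a p∤a

≋-%ℕ : ∀ a m .{{_ : NonZero m}} → a ≋ + (a %ℕ m) [mod m ]
≋-%ℕ a m = congruent (a /ℕ m) (a≡a%ℕn+[a/ℕn]*n a m)

-- Quadratic characters written additively: `Parity` is the field 𝔽₂, and `sgn` sends it to 1 and -1

sgn : Parity → ℤ
sgn 0ℙ = + 1
sgn 1ℙ = -[1+ 0 ]

sgn-+ : ∀ a b → sgn (a ℙ.+ b) ≡ sgn a ℤ.* sgn b
sgn-+ 0ℙ b  = sym (ℤ.*-identityˡ (sgn b))
sgn-+ 1ℙ 0ℙ = refl
sgn-+ 1ℙ 1ℙ = refl

sgn-sq : ∀ a → sgn a ℤ.* sgn a ≡ + 1
sgn-sq 0ℙ = refl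
sgn-sq 1ℙ = refl

sgn-∑ : ∀ {n} (f : Fin n → Parity) → ∏.sum (sgn ∘ f) ≡ sgn (∑ℙ.sum f)
sgn-∑ {zero}  f = refl
sgn-∑ {suc n} f = trans (cong (sgn (f zero) ℤ.*_) (sgn-∑ (f ∘ suc))) (sym (sgn-+ (f zero) _))

∏-const : ∀ {n} (a : ℤ) → ∏.sum {n} (λ _ → a) ≡ a ℤ.^ n
∏-const {zero}  a = refl
∏-const {suc n} a = cong (a ℤ.*_) (∏-const {n} a)

sgn-^ : ∀ a n → sgn a ℤ.^ n ≡ sgn (parity n ℙ.* a)
sgn-^ a zero = refl
sgn-^ a (suc zero) = ℤ.*-identityʳ (sgn a)
sgn-^ a (suc (suc n)) = trans (sym (ℤ.*-assoc (sgn a) (sgn a) _))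
  (trans (cong (ℤ._* sgn a ℤ.^ n) (sgn-sq a)) (trans (ℤ.*-identityˡ _) (sgn-^ a n)))

^-*-distrib : ∀ a b n → (a ℤ.* b) ℤ.^ n ≡ a ℤ.^ n ℤ.* b ℤ.^ n
^-*-distrib a b zero = refl
^-*-distrib a b (suc n) = trans (cong (a ℤ.* b ℤ.*_) (^-*-distrib a b n)) (lemma a b (a ℤ.^ n) (b ℤ.^ n))
  where
  lemma : ∀ a b c d → a ℤ.* b ℤ.* (c ℤ.* d) ≡ a ℤ.* c ℤ.* (b ℤ.* d)
  lemma = solve-∀

parity-suc : ∀ n → parity (suc n) ≡ 1ℙ ℙ.+ parity n
parity-suc n = ℙ.+-homo-+ 1 n

odd : ∀ h → parity (suc (h + h)) ≡ 1ℙ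
odd h = trans (parity-suc (h + h)) (cong (1ℙ ℙ.+_) (trans (ℙ.+-homo-+ h h) (ℙ.p+p≡0ℙ (parity h))))

∏≋̸0 : ∀ {p} → Prime p → ∀ {n} (f : Fin n → ℤ) → (∀ i → ¬ (f i ≋ + 0 [mod p ])) → ¬ (∏.sum f ≋ + 0 [mod p ])
∏≋̸0 pr {zero}  f f≢0 e = 1≋̸0 pr e
∏≋̸0 pr {suc n} f f≢0 e = [ f≢0 zero , ∏≋̸0 pr (f ∘ suc) (f≢0 ∘ suc) ]′ (prime-∣* pr e)

-- Gauss's lemma on the half-system 1, ..., h modulo p = 2 h + 1, and Fermat's little theorem

module GaussLemma (h : ℕ) (pr : Prime (suc (h + h))) where

  p : ℕ
  p = suc (h + h)

  +suc≋̸0 : ∀ (y : Fin h) → ¬ (+ suc (toℕ y) ≋ + 0 [mod p ])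
  +suc≋̸0 y e = contradiction (≋0-small e (s≤s (ℕ.≤-trans (Fin.toℕ<n y) (ℕ.m≤m+n h h)))) λ ()

  -- With the sign -1, p would divide the sum of two elements of 1, ..., h, which is positive and at
  -- most 2 h = p - 1. With +1 both sides are smaller than p.
  ≋sgn-unique : ∀ ε (x y : Fin h) → + suc (toℕ x) ≋ sgn ε ℤ.* + suc (toℕ y) [mod p ] → x ≡ y
  ≋sgn-unique 0ℙ x y e = Fin.toℕ-injective (ℕ.suc-injective
    (≋-small (≋-trans e (≋-reflexive (ℤ.*-identityˡ _))) (s≤s (ℕ.≤-trans (Fin.toℕ<n x) (ℕ.m≤m+n h h))) (s≤s (ℕ.≤-trans (Fin.toℕ<n y) (ℕ.m≤m+n h h)))))
  ≋sgn-unique 1ℙ x y e = contradiction (≋0-small sum≋0 (s≤s (ℕ.+-mono-≤ (Fin.toℕ<n x) (Fin.toℕ<n y)))) λ ()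
    where
    sum≋0 : + (suc (toℕ x) + suc (toℕ y)) ≋ + 0 [mod p ]
    sum≋0 = ≋-trans (≋-+ e (≋-refl {a = + suc (toℕ y)})) (≋-reflexive
      (trans (cong (λ z → z ℤ.+ + suc (toℕ y)) (ℤ.-1*i≡-i (+ suc (toℕ y)))) (ℤ.+-inverseˡ (+ suc (toℕ y)))))

  -- `parities` is recorded next to the residue because reciprocity needs the sum of these relations
  -- over the half-system.
  record AbsLeast (n : ℕ) : Set where
    field
      sign     : Parity
      index    : Fin h
      residue  : + n ≋ sgn sign ℤ.* + suc (toℕ index) [mod p ]
      parities : parity n ≡ parity (n / p) ℙ.+ (parity (suc (toℕ index)) ℙ.+ sign)

  absLeast : ∀ n → ¬ (+ n ≋ + 0 [mod p ]) → AbsLeast n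
  absLeast n n≢0 = go (n % p) refl (≋-% n p) (m%n<n n p)
    where
    parity-n : ∀ r → n % p ≡ r → parity n ≡ parity (n / p) ℙ.+ parity r
    parity-n r eq = begin
      parity n                                          ≡⟨ cong parity (m≡m%n+[m/n]*n n p) ⟩
      parity (n % p + n / p * p)                        ≡⟨ cong (λ z → parity (z + n / p * p)) eq ⟩
      parity (r + n / p * p)                            ≡⟨ ℙ.+-homo-+ r _ ⟩
      parity r ℙ.+ parity (n / p * p)                 ≡⟨ cong (parity r ℙ.+_) (trans (ℙ.*-homo-* (n / p) p) (trans (cong (parity (n / p) ℙ.*_) (odd h)) (ℙ.*-identityʳ _))) ⟩
      parity r ℙ.+ parity (n / p)                     ≡⟨ ℙ.+-comm (parity r) _ ⟩
      parity (n / p) ℙ.+ parity r                     ∎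
      where open ≡-Reasoning
    go : ∀ r → n % p ≡ r → + n ≋ + (n % p) [mod p ] → n % p < p → AbsLeast n
    go zero eq e lt = contradiction (≋-trans e (≋-reflexive (cong +_ eq))) n≢0
    go (suc r) eq e lt with r ℕ.<? h
    ... | yes r<h = record
      { sign = 0ℙ
      ; index = fromℕ< r<h
      ; residue = ≋-trans e (≋-reflexive (trans (cong +_ (trans eq (cong suc (sym (Fin.toℕ-fromℕ< r<h))))) (sym (ℤ.*-identityˡ _))))
      ; parities = trans (parity-n (suc r) eq) (cong (parity (n / p) ℙ.+_)
          (trans (cong (parity ∘ suc) (sym (Fin.toℕ-fromℕ< r<h))) (sym (ℙ.+-identityʳ _))))
      }
    ... | no r≮h = record
      { sign = 1ℙ
      ; index = fromℕ< y<h
      ; residue = ≋-trans e (≋-trans (≋-reflexive (cong +_ eq)) (congruent (+ 1) (begin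
          + suc r                                                 ≡⟨ lemma (+ suc r) (+ suc y) ⟩
          -[1+ 0 ] ℤ.* + suc y ℤ.+ + 1 ℤ.* (+ suc r ℤ.+ + suc y)  ≡⟨ cong₂ (λ a b → -[1+ 0 ] ℤ.* + suc a ℤ.+ + 1 ℤ.* + b) (sym (Fin.toℕ-fromℕ< y<h)) sum ⟩
          -[1+ 0 ] ℤ.* + suc (toℕ (fromℕ< y<h)) ℤ.+ + 1 ℤ.* + p   ∎)))
      ; parities = trans (parity-n (suc r) eq) (cong (parity (n / p) ℙ.+_) par)
      }
      where
      open ≡-Reasoning
      -- `suc y` is p minus the remainder: a remainder above h is replaced by its negative, which
      -- falls in 1, ..., h.
      y = h + h ∸ suc r
      suc-r≤ : suc r ≤ h + h
      suc-r≤ = ℕ.≤-pred (subst (_< p) eq lt)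
      sum : suc r + suc y ≡ p
      sum = trans (ℕ.+-suc (suc r) y) (cong suc (ℕ.m+[n∸m]≡n suc-r≤))
      y<h : y < h
      y<h = ℕ.+-cancelˡ-< h y h (ℕ.<-≤-trans (ℕ.+-monoˡ-< y (s≤s (ℕ.≮⇒≥ r≮h))) (ℕ.≤-reflexive (ℕ.m+[n∸m]≡n suc-r≤)))
      lemma : ∀ a b → a ≡ -[1+ 0 ] ℤ.* b ℤ.+ + 1 ℤ.* (a ℤ.+ b)
      lemma = solve-∀
      par : parity (suc r) ≡ parity (suc (toℕ (fromℕ< y<h))) ℙ.+ 1ℙ
      par = begin
        parity (suc r)                                           ≡⟨ two (parity (suc r)) (parity (suc y)) ⟩
        parity (suc y) ℙ.+ (parity (suc r) ℙ.+ parity (suc y)) ≡⟨ cong (parity (suc y) ℙ.+_) (trans (sym (ℙ.+-homo-+ (suc r) (suc y))) (trans (cong parity sum) (odd h))) ⟩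
        parity (suc y) ℙ.+ 1ℙ                                    ≡⟨ cong (λ z → parity (suc z) ℙ.+ 1ℙ) (sym (Fin.toℕ-fromℕ< y<h)) ⟩
        parity (suc (toℕ (fromℕ< y<h))) ℙ.+ 1ℙ                   ∎
        where
        two : ∀ a b → a ≡ b ℙ.+ (a ℙ.+ b)
        two 0ℙ 0ℙ = refl
        two 0ℙ 1ℙ = refl
        two 1ℙ 0ℙ = refl
        two 1ℙ 1ℙ = refl

  *≋̸0 : ∀ {a} → ¬ (+ a ≋ + 0 [mod p ]) → (x : Fin h) → ¬ (+ (a * suc (toℕ x)) ≋ + 0 [mod p ])
  *≋̸0 {a} a≢0 x e = [ a≢0 , +suc≋̸0 x ]′ (prime-∣* pr (≋-trans (≋-reflexive (sym (ℤ.pos-* a _))) e))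

  ε : ∀ a → ¬ (+ a ≋ + 0 [mod p ]) → Fin h → Parity
  ε a a≢0 x = AbsLeast.sign (absLeast _ (*≋̸0 a≢0 x))

  σ : ∀ a → ¬ (+ a ≋ + 0 [mod p ]) → Fin h → Fin h
  σ a a≢0 x = AbsLeast.index (absLeast _ (*≋̸0 a≢0 x))

  residue : ∀ a (a≢0 : ¬ (+ a ≋ + 0 [mod p ])) x →
            + a ℤ.* + suc (toℕ x) ≋ sgn (ε a a≢0 x) ℤ.* + suc (toℕ (σ a a≢0 x)) [mod p ]
  residue a a≢0 x = ≋-trans (≋-reflexive (sym (ℤ.pos-* a _))) (AbsLeast.residue (absLeast _ (*≋̸0 a≢0 x)))

  -- Multiplying x by a and then by b returns x, while on the half-system it gives a sign times the
  -- composed index; `≋sgn-unique` identifies the two. This is what makes `σ` a permutation.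
  σ-inverse : ∀ a b (a≢0 : ¬ (+ a ≋ + 0 [mod p ])) (b≢0 : ¬ (+ b ≋ + 0 [mod p ])) →
              + b ℤ.* + a ≋ + 1 [mod p ] → ∀ x → σ b b≢0 (σ a a≢0 x) ≡ x
  σ-inverse a b a≢0 b≢0 ba≋1 x = sym (≋sgn-unique (s ℙ.+ t) x (σ b b≢0 y) (begin
    + X                                   ≈⟨ ≋-reflexive (sym (ℤ.*-identityˡ (+ X))) ⟩
    + 1 ℤ.* + X                           ≈⟨ ≋-sym (≋-* ba≋1 (≋-refl {a = + X})) ⟩
    + b ℤ.* + a ℤ.* + X                   ≈⟨ ≋-reflexive (ℤ.*-assoc (+ b) (+ a) (+ X)) ⟩
    + b ℤ.* (+ a ℤ.* + X)                 ≈⟨ ≋-* (≋-refl {a = + b}) (residue a a≢0 x) ⟩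
    + b ℤ.* (sgn s ℤ.* + suc (toℕ y))     ≈⟨ ≋-reflexive (lemma (+ b) (sgn s) (+ suc (toℕ y))) ⟩
    sgn s ℤ.* (+ b ℤ.* + suc (toℕ y))     ≈⟨ ≋-* (≋-refl {a = sgn s}) (residue b b≢0 y) ⟩
    sgn s ℤ.* (sgn t ℤ.* + Z)             ≈⟨ ≋-reflexive (sym (ℤ.*-assoc (sgn s) (sgn t) (+ Z))) ⟩
    sgn s ℤ.* sgn t ℤ.* + Z               ≈⟨ ≋-reflexive (cong (ℤ._* + Z) (sym (sgn-+ s t))) ⟩
    sgn (s ℙ.+ t) ℤ.* + Z                 ∎))
    where
    open ≋-Reasoning p
    X = suc (toℕ x)
    y = σ a a≢0 x
    s = ε a a≢0 x
    t = ε b b≢0 y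
    Z = suc (toℕ (σ b b≢0 y))
    lemma : ∀ b s y → b ℤ.* (s ℤ.* y) ≡ s ℤ.* (b ℤ.* y)
    lemma = solve-∀

  inverse : ∀ a → ¬ (+ a ≋ + 0 [mod p ]) → Σ ℕ λ b → + a ℤ.* + b ≋ + 1 [mod p ]
  inverse a a≢0 with b , e ← coprime⇒inverse (prime-coprime pr (a≢0 ∘ ∣⇒≋0 {a = + a})) =
    b %ℕ p , ≋-trans (≋-* (≋-refl {a = + a}) (≋-sym (≋-%ℕ b p))) e

  inverse≋̸0 : ∀ {a b} → a ℤ.* b ≋ + 1 [mod p ] → ¬ (b ≋ + 0 [mod p ])
  inverse≋̸0 {a} e b≋0 = 1≋̸0 pr (≋-trans (≋-sym e) (≋-trans (≋-* (≋-refl {a = a}) b≋0) (≋-reflexive (ℤ.*-zeroʳ a))))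

  σ-permutation : ∀ a → ¬ (+ a ≋ + 0 [mod p ]) → Permutation′ h
  σ-permutation a a≢0 with b , e ← inverse a a≢0 =
    permutation (σ a a≢0) (σ b b≢0) (σ-inverse b a b≢0 a≢0 e)
      (σ-inverse a b a≢0 b≢0 (≋-trans (≋-reflexive (ℤ.*-comm (+ b) (+ a))) e))
    where
    b≢0 = inverse≋̸0 {+ a} {+ b} e

  gaussSign : ∀ a → ¬ (+ a ≋ + 0 [mod p ]) → Parity
  gaussSign a a≢0 = ∑ℙ.sum (ε a a≢0)

  gauss : ∀ a (a≢0 : ¬ (+ a ≋ + 0 [mod p ])) → (+ a) ℤ.^ h ≋ sgn (gaussSign a a≢0) [mod p ]
  gauss a a≢0 = *-cancelˡ-≋ pr (∏≋̸0 pr fac +suc≋̸0) (begin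
    ∏.sum fac ℤ.* (+ a) ℤ.^ h                                  ≈⟨ ≋-reflexive (trans (cong (∏.sum fac ℤ.*_) (sym (∏-const {h} (+ a)))) (sym (∏.∑-distrib-+ fac (λ _ → + a)))) ⟩
    ∏.sum (λ x → fac x ℤ.* + a)                              ≈⟨ ≋-∏ (λ x → ≋-trans (≋-reflexive (ℤ.*-comm (fac x) (+ a))) (residue a a≢0 x)) ⟩
    ∏.sum (λ x → sgn (ε a a≢0 x) ℤ.* fac (σ a a≢0 x))        ≈⟨ ≋-reflexive (∏.∑-distrib-+ (λ x → sgn (ε a a≢0 x)) (λ x → fac (σ a a≢0 x))) ⟩
    ∏.sum (sgn ∘ ε a a≢0) ℤ.* ∏.sum (λ x → fac (σ a a≢0 x))  ≈⟨ ≋-reflexive (cong₂ ℤ._*_ (sgn-∑ (ε a a≢0)) (sym (∏.sum-permute fac (σ-permutation a a≢0)))) ⟩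
    sgn (gaussSign a a≢0) ℤ.* ∏.sum fac                      ≈⟨ ≋-reflexive (ℤ.*-comm (sgn (gaussSign a a≢0)) (∏.sum fac)) ⟩
    ∏.sum fac ℤ.* sgn (gaussSign a a≢0)                      ∎)
    where
    open ≋-Reasoning p
    fac : Fin h → ℤ
    fac x = + suc (toℕ x)

  -- Summing the parities of a(1+x) = p⌊a(1+x)/p⌋ + residue: since p is odd, changing
  -- a residue r into p − r flips its parity.
  ∑-parities : ∀ a (a≢0 : ¬ (+ a ≋ + 0 [mod p ])) →
    parity a ℙ.* ∑ℙ.sum {h} (λ x → parity (suc (toℕ x))) ≡
    ∑ℙ.sum {h} (λ x → parity (a * suc (toℕ x) / p)) ℙ.+ (∑ℙ.sum {h} (λ x → parity (suc (toℕ x))) ℙ.+ gaussSign a a≢0)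
  ∑-parities a a≢0 = begin
    parity a ℙ.* ∑ℙ.sum {h} par                                   ≡⟨ ∑ℙ.*-distribˡ-sum (parity a) par ⟩
    ∑ℙ.sum {h} (λ x → parity a ℙ.* par x)                         ≡⟨ ∑ℙ.sum-cong-≗ (λ x → trans (sym (ℙ.*-homo-* a (suc (toℕ x)))) (AbsLeast.parities (absLeast _ (*≋̸0 a≢0 x)))) ⟩
    ∑ℙ.sum {h} (λ x → quo x ℙ.+ (par (σ a a≢0 x) ℙ.+ ε a a≢0 x))  ≡⟨ ∑ℙ.∑-distrib-+ quo _ ⟩
    ∑ℙ.sum quo ℙ.+ ∑ℙ.sum (λ x → par (σ a a≢0 x) ℙ.+ ε a a≢0 x)   ≡⟨ cong (∑ℙ.sum quo ℙ.+_) (∑ℙ.∑-distrib-+ (par ∘ σ a a≢0) (ε a a≢0)) ⟩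
    ∑ℙ.sum quo ℙ.+ (∑ℙ.sum (par ∘ σ a a≢0) ℙ.+ gaussSign a a≢0)   ≡⟨ cong (λ z → ∑ℙ.sum quo ℙ.+ (z ℙ.+ gaussSign a a≢0)) (sym (∑ℙ.sum-permute par (σ-permutation a a≢0))) ⟩
    ∑ℙ.sum quo ℙ.+ (∑ℙ.sum par ℙ.+ gaussSign a a≢0)               ∎
    where
    open ≡-Reasoning
    par quo : Fin h → Parity
    par x = parity (suc (toℕ x))
    quo x = parity (a * suc (toℕ x) / p)

  -- Eisenstein's form: for odd a the sum of the half-system occurs once on each side of
  -- `∑-parities` and drops out, leaving the quotients.
  gaussSign-odd : ∀ a (a≢0 : ¬ (+ a ≋ + 0 [mod p ])) → parity a ≡ 1ℙ →
                  gaussSign a a≢0 ≡ ∑ℙ.sum {h} (λ x → parity (a * suc (toℕ x) / p))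
  gaussSign-odd a a≢0 a-odd = solve-for _ _ (gaussSign a a≢0)
    (trans (cong (ℙ._* ∑ℙ.sum {h} (λ x → parity (suc (toℕ x)))) (sym a-odd)) (∑-parities a a≢0))
    where
    solve-for : ∀ s q g → s ≡ q ℙ.+ (s ℙ.+ g) → g ≡ q
    solve-for 0ℙ 0ℙ 0ℙ _ = refl
    solve-for 0ℙ 1ℙ 1ℙ _ = refl
    solve-for 1ℙ 0ℙ 0ℙ _ = refl
    solve-for 1ℙ 1ℙ 1ℙ _ = refl

  -- For a = 2 the left side of `∑-parities` is even, and every quotient vanishes because 2 x < p.
  -- This is the supplementary law, as 1 + ... + h = (p² - 1) / 8.
  gaussSign-2 : ∀ (2≢0 : ¬ (+ 2 ≋ + 0 [mod p ])) → gaussSign 2 2≢0 ≡ ∑ℙ.sum {h} (λ x → parity (suc (toℕ x)))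
  gaussSign-2 2≢0 = solve-for _ (gaussSign 2 2≢0) (trans (∑-parities 2 2≢0) (cong (ℙ._+ (∑ℙ.sum {h} (λ x → parity (suc (toℕ x))) ℙ.+ gaussSign 2 2≢0)) ∑-quotients≡0))
    where
    solve-for : ∀ s g → 0ℙ ≡ s ℙ.+ g → g ≡ s
    solve-for 0ℙ 0ℙ _ = refl
    solve-for 1ℙ 1ℙ _ = refl
    ∑-quotients≡0 : ∑ℙ.sum {h} (λ x → parity (2 * suc (toℕ x) / p)) ≡ 0ℙ
    ∑-quotients≡0 = trans (∑ℙ.sum-cong-≗ {h} (λ x → cong parity (m<n⇒m/n≡0 (2x<p x)))) (∑ℙ.sum-replicate-zero h)
      where
      2x<p : ∀ x → 2 * suc (toℕ x) < p
      2x<p x = s≤s (ℕ.+-mono-≤ (Fin.toℕ<n x) (ℕ.≤-trans (ℕ.≤-reflexive (ℕ.+-identityʳ _)) (Fin.toℕ<n x)))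

  -- a ^ h is a sign by `gauss`, and the square of a sign is 1.
  fermat : ∀ a → ¬ (a ≋ + 0 [mod p ]) → a ℤ.^ (h + h) ≋ + 1 [mod p ]
  fermat a a≢0 = begin
    a ℤ.^ (h + h)           ≈⟨ ≋-^ (h + h) (≋-%ℕ a p) ⟩
    (+ r) ℤ.^ (h + h)         ≈⟨ ≋-reflexive (ℤ.^-distribˡ-+-* (+ r) h h) ⟩
    (+ r) ℤ.^ h ℤ.* (+ r) ℤ.^ h ≈⟨ ≋-* (gauss r r≢0) (gauss r r≢0) ⟩
    sgn (gaussSign r r≢0) ℤ.* sgn (gaussSign r r≢0) ≈⟨ ≋-reflexive (sgn-sq (gaussSign r r≢0)) ⟩
    + 1                     ∎
    where
    open ≋-Reasoning p
    r = a %ℕ p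
    r≢0 : ¬ (+ r ≋ + 0 [mod p ])
    r≢0 e = a≢0 (≋-trans (≋-%ℕ a p) e)

-- Counting modulo 2, and quadratic reciprocity

χ : {P : Set} → Dec P → Parity
χ (yes _) = 1ℙ
χ (no  _) = 0ℙ

χ-cong : {P Q : Set} (P? : Dec P) (Q? : Dec Q) → (P → Q) → (Q → P) → χ P? ≡ χ Q?
χ-cong (yes _) (yes _) _ _ = refl
χ-cong (yes p) (no ¬q) f _ = contradiction (f p) ¬q
χ-cong (no ¬p) (yes q) _ g = contradiction (g q) ¬p
χ-cong (no _)  (no _)  _ _ = refl

∑-const : ∀ n c → ∑ℙ.sum {n} (λ _ → c) ≡ parity n ℙ.* c
∑-const zero    c = refl
∑-const (suc n) c = begin
  c ℙ.+ ∑ℙ.sum {n} (λ _ → c)     ≡⟨ cong (c ℙ.+_) (∑-const n c) ⟩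
  c ℙ.+ (parity n ℙ.* c)           ≡⟨ sym (ℙ.*-distribʳ-+ c 1ℙ (parity n)) ⟩
  (1ℙ ℙ.+ parity n) ℙ.* c        ≡⟨ cong (ℙ._* c) (sym (parity-suc n)) ⟩
  parity (suc n) ℙ.* c           ∎
  where open ≡-Reasoning

∑-below : ∀ k q → q ≤ k → ∑ℙ.sum {k} (λ y → χ (toℕ y ℕ.<? q)) ≡ parity q
∑-below k zero q≤k = trans (trans (∑ℙ.sum-cong-≗ {k} (λ y → χ-cong {Q = ⊥} (toℕ y ℕ.<? 0) (no id) (λ ()) (λ ()))) (∑-const k 0ℙ)) (ℙ.*-zeroʳ (parity k))
∑-below (suc k) (suc q) (s≤s q≤k) = begin
  χ (0 ℕ.<? suc q) ℙ.+ ∑ℙ.sum {k} (λ y → χ (suc (toℕ y) ℕ.<? suc q))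
    ≡⟨ cong₂ ℙ._+_ (χ-cong {Q = 0 ≡ 0} (0 ℕ.<? suc q) (yes refl) (λ _ → refl) (λ _ → s≤s z≤n))
                   (∑ℙ.sum-cong-≗ {k} (λ y → χ-cong (suc (toℕ y) ℕ.<? suc q) (toℕ y ℕ.<? q) ℕ.≤-pred s≤s)) ⟩
  1ℙ ℙ.+ ∑ℙ.sum {k} (λ y → χ (toℕ y ℕ.<? q))  ≡⟨ cong (1ℙ ℙ.+_) (∑-below k q q≤k) ⟩
  1ℙ ℙ.+ parity q                             ≡⟨ sym (parity-suc q) ⟩
  parity (suc q)                              ∎
  where open ≡-Reasoning

-- The quotient n / m counts the multiples m, 2 m, ... that are at most n. It turns Eisenstein's
-- quotients into numbers of lattice points in a column of height k.
parity-quotient : ∀ n m .{{_ : NonZero m}} k → n / m ≤ k → parity (n / m) ≡ ∑ℙ.sum {k} (λ y → χ (m * suc (toℕ y) ℕ.≤? n))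
parity-quotient n m k le = trans (sym (∑-below k (n / m) le))
  (∑ℙ.sum-cong-≗ {k} (λ y → χ-cong (toℕ y ℕ.<? n / m) (m * suc (toℕ y) ℕ.≤? n) (to (toℕ y)) (from (toℕ y))))
  where
  to : ∀ y → y < n / m → m * suc y ≤ n
  to y lt = ℕ.≤-trans (ℕ.≤-reflexive (ℕ.*-comm m (suc y))) (ℕ.≤-trans (ℕ.*-monoˡ-≤ m lt) (m/n*n≤m n m))
  from : ∀ y → m * suc y ≤ n → y < n / m
  from y le = subst (_≤ n / m) (m*n/n≡m (suc y) m) (/-monoˡ-≤ m (ℕ.≤-trans (ℕ.≤-reflexive (ℕ.*-comm (suc y) m)) le))

module _ (h k : ℕ) (h-prime : Prime (suc (h + h))) (k-prime : Prime (suc (k + k)))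
         (a≢0 : ¬ (+ suc (k + k) ≋ + 0 [mod suc (h + h) ])) (p≢0 : ¬ (+ suc (h + h) ≋ + 0 [mod suc (k + k) ])) where

  private
    module Gp = GaussLemma h h-prime
    module Ga = GaussLemma k k-prime

  -- Over abscissae up to h the line of slope (2 k + 1) / (2 h + 1) stays below height k + 1, so no
  -- lattice point under it leaves the rectangle.
  lattice : ∀ h k x → x ≤ h → suc (k + k) * x / suc (h + h) ≤ k
  lattice h k x x≤h = ℕ.≤-pred (m<n*o⇒m/o<n (ℕ.≤-<-trans (ℕ.*-monoʳ-≤ (suc (k + k)) x≤h)
    (subst (suc (k + k) * h <_) (sym (lemma h k)) (ℕ.m<m+n _ (s≤s z≤n)))))
    where
    lemma : ∀ h k → suc k * suc (h + h) ≡ suc (k + k) * h + suc (h + k)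
    lemma = ℕSolver.solve-∀

  -- Each point (x , y) of the h × k rectangle lies strictly on one side of the line a x = p y.
  quadratic-reciprocity : Gp.gaussSign (suc (k + k)) a≢0 ℙ.+ Ga.gaussSign (suc (h + h)) p≢0 ≡ parity h ℙ.* parity k
  quadratic-reciprocity = begin
    Gp.gaussSign a a≢0 ℙ.+ Ga.gaussSign p p≢0
      ≡⟨ cong₂ ℙ._+_ (Gp.gaussSign-odd a a≢0 (odd k)) (Ga.gaussSign-odd p p≢0 (odd h)) ⟩
    ∑ℙ.sum {h} (λ x → parity (a * suc (toℕ x) / p)) ℙ.+ ∑ℙ.sum {k} (λ y → parity (p * suc (toℕ y) / a))
      ≡⟨ cong₂ ℙ._+_ (∑ℙ.sum-cong-≗ {h} (λ x → parity-quotient (a * suc (toℕ x)) p k (lattice h k _ (Fin.toℕ<n x))))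
                     (∑ℙ.sum-cong-≗ {k} (λ y → parity-quotient (p * suc (toℕ y)) a h (lattice k h _ (Fin.toℕ<n y)))) ⟩
    ∑ℙ.sum {h} (λ x → ∑ℙ.sum {k} (λ y → below x y)) ℙ.+ ∑ℙ.sum {k} (λ y → ∑ℙ.sum {h} (λ x → above x y))
      ≡⟨ cong (∑ℙ.sum {h} (λ x → ∑ℙ.sum {k} (λ y → below x y)) ℙ.+_) (sym (∑ℙ.∑-comm above)) ⟩
    ∑ℙ.sum {h} (λ x → ∑ℙ.sum {k} (λ y → below x y)) ℙ.+ ∑ℙ.sum {h} (λ x → ∑ℙ.sum {k} (λ y → above x y))
      ≡⟨ sym (∑ℙ.∑-distrib-+ {h} (λ x → ∑ℙ.sum {k} (below x)) (λ x → ∑ℙ.sum {k} (above x))) ⟩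
    ∑ℙ.sum {h} (λ x → ∑ℙ.sum {k} (λ y → below x y) ℙ.+ ∑ℙ.sum {k} (λ y → above x y))
      ≡⟨ ∑ℙ.sum-cong-≗ {h} (λ x → trans (sym (∑ℙ.∑-distrib-+ {k} (below x) (above x)))
           (trans (∑ℙ.sum-cong-≗ {k} (one-side x)) (trans (∑-const k 1ℙ) (ℙ.*-identityʳ (parity k))))) ⟩
    ∑ℙ.sum {h} (λ x → parity k)
      ≡⟨ ∑-const h (parity k) ⟩
    parity h ℙ.* parity k ∎
    where
    open ≡-Reasoning
    a = suc (k + k)
    p = suc (h + h)
    below above : Fin h → Fin k → Parity
    below x y = χ (p * suc (toℕ y) ℕ.≤? a * suc (toℕ x))
    above x y = χ (a * suc (toℕ x) ℕ.≤? p * suc (toℕ y))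
    one-side : ∀ x y → below x y ℙ.+ above x y ≡ 1ℙ
    one-side x y with p * suc (toℕ y) ℕ.≤? a * suc (toℕ x) | a * suc (toℕ x) ℕ.≤? p * suc (toℕ y)
    -- A point on the line would give a x = p y, and p would divide a x although it divides neither
    -- factor.
    ... | yes le | yes ge = contradiction
            (≋-trans (≋-reflexive (trans (cong +_ (ℕ.≤-antisym ge le)) (ℤ.pos-* p _)))
                     (≋-trans (≋-* m≋0 (≋-refl {a = + suc (toℕ y)})) (≋-reflexive (ℤ.*-zeroˡ (+ suc (toℕ y))))))
            (Gp.*≋̸0 a≢0 x)
    ... | yes _  | no _   = refl
    ... | no _   | yes _  = refl
    ... | no ¬le | no ¬ge = contradiction (ℕ.<⇒≤ (ℕ.≰⇒> ¬le)) ¬ge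

-- Lagrange's theorem on roots modulo p, and quadratic nonresidues

-- The value at x of the monic polynomial whose non-leading coefficients, lowest first, are cs.
monic : ∀ {n} → Vec ℤ n → ℤ → ℤ
monic []       x = + 1
monic (c ∷ cs) x = c ℤ.+ x ℤ.* monic cs x

-- The quotient of c ∷ cs by x − r, whatever c: the coefficient c only affects the remainder.
deflate : ∀ {n} → ℤ → Vec ℤ n → Vec ℤ n
deflate r []       = []
deflate r (c ∷ cs) = monic (c ∷ cs) r ∷ deflate r cs

-- The factor theorem for `c ∷ cs`: the constant c cancels from the difference of the values at x
-- and r, so it is left out of the statement.
monic-deflate : ∀ {n} (cs : Vec ℤ n) r x → x ℤ.* monic cs x ℤ.- r ℤ.* monic cs r ≡ (x ℤ.- r) ℤ.* monic (deflate r cs) x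
monic-deflate [] r x = lemma r x
  where
  lemma : ∀ r x → x ℤ.* + 1 ℤ.- r ℤ.* + 1 ≡ (x ℤ.- r) ℤ.* + 1
  lemma = solve-∀
monic-deflate (c ∷ cs) r x = begin
  x ℤ.* (c ℤ.+ x ℤ.* X) ℤ.- r ℤ.* (c ℤ.+ r ℤ.* R)           ≡⟨ lemma₁ c r x X R ⟩
  (x ℤ.- r) ℤ.* (c ℤ.+ r ℤ.* R) ℤ.+ x ℤ.* (x ℤ.* X ℤ.- r ℤ.* R) ≡⟨ cong (λ z → (x ℤ.- r) ℤ.* (c ℤ.+ r ℤ.* R) ℤ.+ x ℤ.* z) (monic-deflate cs r x) ⟩
  (x ℤ.- r) ℤ.* (c ℤ.+ r ℤ.* R) ℤ.+ x ℤ.* ((x ℤ.- r) ℤ.* Q) ≡⟨ lemma₂ (x ℤ.- r) (c ℤ.+ r ℤ.* R) x Q ⟩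
  (x ℤ.- r) ℤ.* (c ℤ.+ r ℤ.* R ℤ.+ x ℤ.* Q)                 ∎
  where
  open ≡-Reasoning
  X = monic cs x
  R = monic cs r
  Q = monic (deflate r cs) x
  lemma₁ : ∀ c r x X R → x ℤ.* (c ℤ.+ x ℤ.* X) ℤ.- r ℤ.* (c ℤ.+ r ℤ.* R) ≡ (x ℤ.- r) ℤ.* (c ℤ.+ r ℤ.* R) ℤ.+ x ℤ.* (x ℤ.* X ℤ.- r ℤ.* R)
  lemma₁ = solve-∀
  lemma₂ : ∀ d e x Q → d ℤ.* e ℤ.+ x ℤ.* (d ℤ.* Q) ≡ d ℤ.* (e ℤ.+ x ℤ.* Q)
  lemma₂ = solve-∀

-- Dividing by x - r for the first root leaves a monic polynomial of degree one less. Since p is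
-- prime, the other roots, being distinct from r modulo p, are roots of the quotient. In degree 0
-- the polynomial is 1.
lagrange : ∀ {p} → Prime p → ∀ {n} (cs : Vec ℤ n) (r : Fin (suc n) → ℤ) →
           (∀ {i j} → r i ≋ r j [mod p ] → i ≡ j) → ¬ (∀ i → monic cs (r i) ≋ + 0 [mod p ])
lagrange pr []       r distinct roots = 1≋̸0 pr (roots zero)
lagrange {p} pr (c ∷ cs) r distinct roots = lagrange pr (deflate r₀ cs) (r ∘ suc) (Fin.suc-injective ∘ distinct) roots′
  where
  r₀ = r zero
  lemma : ∀ c a b → c ℤ.+ a ℤ.- (c ℤ.+ b) ≡ a ℤ.- b
  lemma = solve-∀
  roots′ : ∀ i → monic (deflate r₀ cs) (r (suc i)) ≋ + 0 [mod p ]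
  roots′ i = [ (λ e → contradiction (distinct (-≋0⇒≋ e)) λ ()) , id ]′ (prime-∣* pr (≋-trans
    (≋-reflexive (trans (sym (monic-deflate cs r₀ (r (suc i)))) (sym (lemma c _ _))))
    (≋⇒-≋0 (≋-trans (roots (suc i)) (≋-sym (roots zero))))))

monic-x^n : ∀ n x → monic (replicate n (+ 0)) x ≡ x ℤ.^ n
monic-x^n zero    x = refl
monic-x^n (suc n) x = trans (ℤ.+-identityˡ _) (cong (x ℤ.*_) (monic-x^n n x))

sgn-≋-injective : ∀ {m} → 2 < m → ∀ a b → sgn a ≋ sgn b [mod m ] → a ≡ b
sgn-≋-injective 2<m 0ℙ 0ℙ e = refl
sgn-≋-injective 2<m 1ℙ 1ℙ e = refl
sgn-≋-injective 2<m 0ℙ 1ℙ e = contradiction (≋0-small (≋⇒-≋0 e) 2<m) λ ()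
sgn-≋-injective 2<m 1ℙ 0ℙ e = contradiction (≋0-small (≋⇒-≋0 (≋-sym e)) 2<m) λ ()

half>0 : ∀ h → Prime (suc (h + h)) → 0 < h
half>0 zero    pr = contradiction pr ¬prime[1]
half>0 (suc h) pr = s≤s z≤n

not-all-roots-of-unity : ∀ {p} → Prime p → ∀ n → 0 < n → suc n < p → ¬ (∀ (i : Fin (suc n)) → (+ suc (toℕ i)) ℤ.^ n ≋ + 1 [mod p ])
not-all-roots-of-unity {p} pr (suc n) _ n<p all = lagrange pr {n = suc n} (-[1+ 0 ] ∷ replicate n (+ 0)) (λ i → + suc (toℕ i)) distinct
  λ i → ≋-trans (≋-reflexive (trans (cong (λ z → -[1+ 0 ] ℤ.+ + suc (toℕ i) ℤ.* z) (monic-x^n n _)) (ℤ.+-comm -[1+ 0 ] ((+ suc (toℕ i)) ℤ.^ suc n)))) (≋⇒-≋0 (all i))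
  where
  small : (i : Fin (suc (suc n))) → suc (toℕ i) < p
  small i = ℕ.≤-<-trans (Fin.toℕ<n i) n<p
  distinct : ∀ {i j : Fin (suc (suc n))} → + suc (toℕ i) ≋ + suc (toℕ j) [mod p ] → i ≡ j
  distinct {i} {j} e = Fin.toℕ-injective (ℕ.suc-injective (≋-small e (small i) (small j)))

≢1⇒≡0 : ∀ {a} → a ≢ 1ℙ → a ≡ 0ℙ
≢1⇒≡0 {0ℙ} _ = refl
≢1⇒≡0 {1ℙ} a≢1 = contradiction refl a≢1

module _ (h : ℕ) (pr : Prime (suc (h + h))) where
  open GaussLemma h pr

  private
    0<h : 0 < h
    0<h = half>0 h pr

    small : (i : Fin (suc h)) → suc (toℕ i) < p
    small i = s≤s (ℕ.≤-trans (Fin.toℕ<n i) (ℕ.+-monoˡ-≤ h 0<h))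

    small≢0 : (i : Fin (suc h)) → ¬ (+ suc (toℕ i) ≋ + 0 [mod p ])
    small≢0 i e = contradiction (≋0-small e (small i)) λ ()

  -- Searching 1, ..., h + 1 is enough: if all their Gauss signs were 1, x ^ h - 1 would have h + 1
  -- roots modulo p.
  nonresidue : Σ ℕ λ c → ¬ (+ c ≋ + 0 [mod p ]) × (+ c) ℤ.^ h ≋ -[1+ 0 ] [mod p ]
  nonresidue with Fin.any? (λ i → gaussSign (suc (toℕ i)) (small≢0 i) ℙ.≟ 1ℙ)
  ... | yes (i , eq) = suc (toℕ i) , small≢0 i , ≋-trans (gauss _ (small≢0 i)) (≋-reflexive (cong sgn eq))
  ... | no ¬any = contradiction
          (λ i → ≋-trans (gauss _ (small≢0 i)) (≋-reflexive (cong sgn (≢1⇒≡0 (λ eq → ¬any (i , eq))))))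
          (not-all-roots-of-unity pr h 0<h (s≤s (ℕ.+-monoˡ-≤ h 0<h)))

  character-value : 1 < h → ∀ τ → Σ ℕ λ c → ¬ (+ c ≋ + 0 [mod p ]) × ¬ (+ c ≋ + 1 [mod p ]) × (+ c) ℤ.^ h ≋ sgn τ [mod p ]
  -- 4 is a square, and modulo p ≥ 5 it is neither 0 nor 1. Modulo 3 it would be 1, whence the
  -- hypothesis `1<h`.
  character-value 1<h 0ℙ = 4 , (λ e → contradiction (≋0-small e 4<p) λ ()) , (λ e → contradiction (≋-small e 4<p 1<p) λ ()) ,
    ≋-trans (≋-reflexive (trans (^-*-distrib (+ 2) (+ 2) h) (sym (ℤ.^-distribˡ-+-* (+ 2) h h))))
            (fermat (+ 2) (λ e → contradiction (≋0-small e 2<p) λ ()))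
    where
    4<p : 4 < p
    4<p = s≤s (ℕ.+-mono-≤ 1<h 1<h)
    2<p : 2 < p
    2<p = ℕ.<-trans (s≤s (s≤s (s≤s z≤n))) 4<p
    1<p : 1 < p
    1<p = ℕ.<-trans (s≤s (s≤s z≤n)) 2<p
  character-value 1<h 1ℙ with c , c≢0 , e ← nonresidue = c , c≢0 , c≢1 , e
    where
    c≢1 : ¬ (+ c ≋ + 1 [mod p ])
    c≢1 c≋1 = contradiction (sgn-≋-injective (s≤s (ℕ.+-mono-≤ 0<h 0<h)) 0ℙ 1ℙ
      (≋-trans (≋-reflexive (sym (ℤ.^-zeroˡ h))) (≋-trans (≋-sym (≋-^ h c≋1)) e))) λ ()

-- Linear systems over 𝔽₂

δ : ∀ {n} → Fin n → Fin n → Parity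
δ i k = χ (i Fin.≟ k)

∑-0 : ∀ {n} {f : Fin n → Parity} → (∀ i → f i ≡ 0ℙ) → ∑ℙ.sum f ≡ 0ℙ
∑-0 {n} f≡0 = trans (∑ℙ.sum-cong-≗ f≡0) (∑ℙ.sum-replicate-zero n)

∑-δ : ∀ {n} (i : Fin n) (f : Fin n → Parity) → ∑ℙ.sum (λ k → δ i k ℙ.* f k) ≡ f i
∑-δ {suc n} zero f = trans (cong (f zero ℙ.+_) (∑-0 {n} λ _ → refl)) (ℙ.+-identityʳ (f zero))
∑-δ {suc n} (suc i) f = trans (∑ℙ.sum-cong-≗ {n} (λ k → cong (ℙ._* f (suc k)) (χ-cong (suc i Fin.≟ suc k) (i Fin.≟ k) Fin.suc-injective (cong suc)))) (∑-δ i (f ∘ suc))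

-- Row k of the reduced system is row k plus `v k` times the pivot row i. A combination e of the
-- reduced rows is therefore one of the original rows in which the pivot row receives the additional
-- coefficient Σ `e l * v l`. Here `f` is any column, or the right-hand side.
elimination : ∀ {s} (e v f : Fin s → Parity) (i : Fin s) →
  ∑ℙ.sum (λ k → (e k ℙ.+ (∑ℙ.sum (λ l → e l ℙ.* v l) ℙ.* δ i k)) ℙ.* f k) ≡
  ∑ℙ.sum (λ k → e k ℙ.* (f k ℙ.+ (v k ℙ.* f i)))
elimination e v f i = begin
  ∑ℙ.sum (λ k → (e k ℙ.+ (E ℙ.* δ i k)) ℙ.* f k)
    ≡⟨ ∑ℙ.sum-cong-≗ (λ k → trans (ℙ.*-distribʳ-+ (f k) (e k) (E ℙ.* δ i k)) (cong ((e k ℙ.* f k) ℙ.+_) (ℙ.*-assoc E (δ i k) (f k)))) ⟩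
  ∑ℙ.sum (λ k → (e k ℙ.* f k) ℙ.+ (E ℙ.* (δ i k ℙ.* f k)))
    ≡⟨ ∑ℙ.∑-distrib-+ (λ k → e k ℙ.* f k) (λ k → E ℙ.* (δ i k ℙ.* f k)) ⟩
  ∑ℙ.sum (λ k → e k ℙ.* f k) ℙ.+ ∑ℙ.sum (λ k → E ℙ.* (δ i k ℙ.* f k))
    ≡⟨ cong (∑ℙ.sum (λ k → e k ℙ.* f k) ℙ.+_) (trans (sym (∑ℙ.*-distribˡ-sum E (λ k → δ i k ℙ.* f k))) (cong (E ℙ.*_) (∑-δ i f))) ⟩
  ∑ℙ.sum (λ k → e k ℙ.* f k) ℙ.+ (E ℙ.* f i)
    ≡⟨ cong (∑ℙ.sum (λ k → e k ℙ.* f k) ℙ.+_) (∑ℙ.*-distribʳ-sum (f i) (λ k → e k ℙ.* v k)) ⟩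
  ∑ℙ.sum (λ k → e k ℙ.* f k) ℙ.+ ∑ℙ.sum (λ k → e k ℙ.* v k ℙ.* f i)
    ≡⟨ sym (∑ℙ.∑-distrib-+ (λ k → e k ℙ.* f k) (λ k → e k ℙ.* v k ℙ.* f i)) ⟩
  ∑ℙ.sum (λ k → (e k ℙ.* f k) ℙ.+ (e k ℙ.* v k ℙ.* f i))
    ≡⟨ ∑ℙ.sum-cong-≗ (λ k → trans (cong ((e k ℙ.* f k) ℙ.+_) (ℙ.*-assoc (e k) (v k) (f i))) (sym (ℙ.*-distribˡ-+ (e k) (f k) (v k ℙ.* f i)))) ⟩
  ∑ℙ.sum (λ k → e k ℙ.* (f k ℙ.+ (v k ℙ.* f i))) ∎
  where
  open ≡-Reasoning
  E = ∑ℙ.sum (λ l → e l ℙ.* v l)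

Solution Obstruction : ∀ {s t} → (Fin s → Fin t → Parity) → (Fin s → Parity) → Set
Solution    {s} {t} V b = Σ (Fin t → Parity) λ φ → ∀ i → ∑ℙ.sum (λ j → V i j ℙ.* φ j) ≡ b i
Obstruction {s} {t} V b = Σ (Fin s → Parity) λ e → (∀ j → ∑ℙ.sum (λ i → e i ℙ.* V i j) ≡ 0ℙ) × ∑ℙ.sum (λ i → e i ℙ.* b i) ≡ 1ℙ

-- Gaussian elimination, one column at a time.
fredholm : ∀ {s} t (V : Fin s → Fin t → Parity) (b : Fin s → Parity) → Solution V b ⊎ Obstruction V b
fredholm zero V b with Fin.any? (λ i → b i ℙ.≟ 1ℙ)
... | yes (i , bᵢ≡1) = inj₂ (δ i , (λ ()) , trans (∑-δ i b) bᵢ≡1)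
... | no  b≢1        = inj₁ ((λ ()) , λ i → sym (≢1⇒≡0 λ bᵢ≡1 → b≢1 (i , bᵢ≡1)))
fredholm (suc t) V b with Fin.any? (λ i → V i zero ℙ.≟ 1ℙ)
... | no V₀≢1 = [ (λ (φ , sol) → inj₁ ((λ { zero → 0ℙ ; (suc j) → φ j }) ,
                     λ i → trans (cong (ℙ._+ ∑ℙ.sum (λ j → V i (suc j) ℙ.* φ j)) (ℙ.*-zeroʳ (V i zero))) (sol i)))
                , (λ (e , rel , odd) → inj₂ (e , (λ { zero → ∑-0 (λ i → trans (cong (e i ℙ.*_) (V₀≡0 i)) (ℙ.*-zeroʳ (e i))) ; (suc j) → rel j }) , odd))
                ]′ (fredholm t (λ i j → V i (suc j)) b)
  where
  V₀≡0 : ∀ i → V i zero ≡ 0ℙ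
  V₀≡0 i = ≢1⇒≡0 λ Vᵢ≡1 → V₀≢1 (i , Vᵢ≡1)
... | yes (i₀ , pivot) = [ inj₁ ∘ extend , inj₂ ∘ lift ]′ (fredholm t W c)
  where
  v = λ i → V i zero
  -- The pivot row itself reduces to 0 = 0, because `v i₀` is 1 and 1 + 1 = 0. It can stay in the
  -- system, and the recursion is on the columns alone.
  W = λ i j → V i (suc j) ℙ.+ (v i ℙ.* V i₀ (suc j))
  c = λ i → b i ℙ.+ (v i ℙ.* b i₀)
  extend : Solution W c → Solution V b
  -- The first unknown is read off the pivot equation, in which its coefficient is 1.
  extend (φ , sol) = (λ { zero → b i₀ ℙ.+ row i₀ ; (suc j) → φ j }) , λ i → solve-for (v i) (b i₀) (row i₀) (row i) (b i) (trans (sym (reduced i)) (sol i))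
    where
    row : Fin _ → Parity
    row i = ∑ℙ.sum (λ j → V i (suc j) ℙ.* φ j)
    reduced : ∀ i → ∑ℙ.sum (λ j → W i j ℙ.* φ j) ≡ row i ℙ.+ (v i ℙ.* row i₀)
    reduced i = begin
      ∑ℙ.sum (λ j → W i j ℙ.* φ j)
        ≡⟨ ∑ℙ.sum-cong-≗ (λ j → trans (ℙ.*-distribʳ-+ (φ j) (V i (suc j)) (v i ℙ.* V i₀ (suc j))) (cong ((V i (suc j) ℙ.* φ j) ℙ.+_) (ℙ.*-assoc (v i) (V i₀ (suc j)) (φ j)))) ⟩
      ∑ℙ.sum (λ j → (V i (suc j) ℙ.* φ j) ℙ.+ (v i ℙ.* (V i₀ (suc j) ℙ.* φ j)))
        ≡⟨ ∑ℙ.∑-distrib-+ (λ j → V i (suc j) ℙ.* φ j) (λ j → v i ℙ.* (V i₀ (suc j) ℙ.* φ j)) ⟩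
      row i ℙ.+ ∑ℙ.sum (λ j → v i ℙ.* (V i₀ (suc j) ℙ.* φ j))
        ≡⟨ cong (row i ℙ.+_) (sym (∑ℙ.*-distribˡ-sum (v i) (λ j → V i₀ (suc j) ℙ.* φ j))) ⟩
      row i ℙ.+ (v i ℙ.* row i₀) ∎
      where open ≡-Reasoning
    solve-for : ∀ v b₀ r₀ r b → r ℙ.+ (v ℙ.* r₀) ≡ b ℙ.+ (v ℙ.* b₀) → (v ℙ.* (b₀ ℙ.+ r₀)) ℙ.+ r ≡ b
    solve-for 0ℙ b₀ r₀ r b e = trans (sym (ℙ.+-identityʳ r)) (trans e (ℙ.+-identityʳ b))
    solve-for 1ℙ b₀ r₀ r b e = begin
      b₀ ℙ.+ r₀ ℙ.+ r        ≡⟨ ℙ.+-assoc b₀ r₀ r ⟩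
      b₀ ℙ.+ (r₀ ℙ.+ r)      ≡⟨ cong (b₀ ℙ.+_) (trans (ℙ.+-comm r₀ r) e) ⟩
      b₀ ℙ.+ (b ℙ.+ b₀)      ≡⟨ cong (b₀ ℙ.+_) (ℙ.+-comm b b₀) ⟩
      b₀ ℙ.+ (b₀ ℙ.+ b)      ≡⟨ sym (ℙ.+-assoc b₀ b₀ b) ⟩
      b₀ ℙ.+ b₀ ℙ.+ b        ≡⟨ cong (ℙ._+ b) (ℙ.p+p≡0ℙ b₀) ⟩
      b                      ∎
      where open ≡-Reasoning
  lift : Obstruction W c → Obstruction V b
  lift (e , rel , odd) = (λ k → e k ℙ.+ (∑ℙ.sum (λ l → e l ℙ.* v l) ℙ.* δ i₀ k)) ,
    (λ { zero    → trans (elimination e v v i₀) (∑-0 λ k → trans (cong (λ z → e k ℙ.* (v k ℙ.+ (v k ℙ.* z))) pivot)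
                     (trans (cong (λ z → e k ℙ.* (v k ℙ.+ z)) (ℙ.*-identityʳ (v k))) (trans (cong (e k ℙ.*_) (ℙ.p+p≡0ℙ (v k))) (ℙ.*-zeroʳ (e k)))))
       ; (suc j) → trans (elimination e v (λ k → V k (suc j)) i₀) (rel j) }) ,
    trans (elimination e v b i₀) odd

-- Integers as squares times products of -1 and primes

squarefree-part : ∀ n → 0 < n → Σ ℕ λ f → Σ ℕ λ d → (n ≡ f * f * d) × SquareFree (+ d)
squarefree-part = <-rec _ step
  where
  step : ∀ n → (∀ {m} → m < n → 0 < m → Σ ℕ λ f → Σ ℕ λ d → (m ≡ f * f * d) × SquareFree (+ d)) →
         0 < n → Σ ℕ λ f → Σ ℕ λ d → (n ≡ f * f * d) × SquareFree (+ d)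
  -- If m ^ 2 divides n then m is at most n, so the candidates 2 + i with i < n exhaust the squares
  -- to be split off.
  step n@(suc _) rec _ with Fin.any? {n} (λ i → (2 + toℕ i) * (2 + toℕ i) ℕD.∣? n)
  ... | no none = 1 , n , sym (ℕ.+-identityʳ n) , squarefree
    where
    squarefree : SquareFree (+ n)
    squarefree zero m²∣n = contradiction (ℕD.0∣⇒≡0 m²∣n) λ ()
    squarefree (suc zero) _ = refl
    squarefree m@(suc (suc i)) m²∣n = contradiction (fromℕ< i<n , subst (λ k → (2 + k) * (2 + k) ℕ∣ n) (sym (Fin.toℕ-fromℕ< i<n)) m²∣n) none
      where
      i<n : i < n
      i<n = ℕ.<-≤-trans (ℕ.m<n⇒m<1+n ℕ.≤-refl) (ℕD.∣⇒≤ (ℕD.∣-trans (ℕD.m∣m*n m) m²∣n))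
  ... | yes (i , ℕdivides zero ())
  ... | yes (i , ℕdivides q@(suc _) n≡q*m²)
    with f , d , q≡f²d , sf ← rec (subst (q <_) (sym n≡q*m²) (ℕ.m<m*n q _ (s≤s (s≤s z≤n)))) (s≤s z≤n) =
    f * m , d , trans n≡q*m² (trans (cong (_* (m * m)) q≡f²d) (lemma f d m)) , sf
    where
    m = 2 + toℕ i
    lemma : ∀ f d m → f * f * d * (m * m) ≡ f * m * (f * m) * d
    lemma = ℕSolver.solve-∀

-- Index 0 is not a prime and is used for -1, so that -1 and the primes up to B are indexed by
-- `Fin (suc B)`. Indices that are not `Admissible` occur only with exponent 0.
generator : ℕ → ℤ
generator zero    = -[1+ 0 ]
generator (suc k) = + suc k

Admissible : ℕ → Set
Admissible k = k ≡ 0 ⊎ (Prime k × k ≢ 3)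

monomial : ∀ {n} → (Fin n → ℕ) → ℤ
monomial v = ∏.sum (λ k → generator (toℕ k) ℤ.^ v k)

raise : ∀ {n} → Fin n → (Fin n → ℕ) → Fin n → ℕ
raise zero    v zero    = suc (v zero)
raise zero    v (suc k) = v (suc k)
raise (suc i) v zero    = v zero
raise (suc i) v (suc k) = raise i (v ∘ suc) k

∏-raise : ∀ {n} (f : Fin n → ℤ) i v → ∏.sum (λ k → f k ℤ.^ raise i v k) ≡ f i ℤ.* ∏.sum (λ k → f k ℤ.^ v k)
∏-raise f zero    v = ℤ.*-assoc (f zero) (f zero ℤ.^ v zero) _
∏-raise f (suc i) v = trans (cong (f zero ℤ.^ v zero ℤ.*_) (∏-raise (f ∘ suc) i (v ∘ suc))) (lemma (f zero ℤ.^ v zero) (f (suc i)) _)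
  where
  lemma : ∀ a b c → a ℤ.* (b ℤ.* c) ≡ b ℤ.* (a ℤ.* c)
  lemma = solve-∀

raise-support : ∀ {n} (i : Fin n) v {k} → raise i v k ≢ 0 → k ≡ i ⊎ v k ≢ 0
raise-support zero    v {zero}  _ = inj₁ refl
raise-support zero    v {suc k} ne = inj₂ ne
raise-support (suc i) v {zero}  ne = inj₂ ne
raise-support (suc i) v {suc k} ne = [ inj₁ ∘ cong suc , inj₂ ]′ (raise-support i (v ∘ suc) ne)

Monomial : ℕ → ℤ → Set
Monomial B d = Σ (Fin (suc B) → ℕ) λ v → (d ≡ monomial v) × (∀ k → v k ≢ 0 → Admissible (toℕ k))

monomial-1 : ∀ B → Monomial B (+ 1)
monomial-1 B = (λ _ → 0) , sym (∏.sum-replicate-zero (suc B)) , λ k 0≢0 → contradiction refl 0≢0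

monomial-* : ∀ {B d} k → k ≤ B → Admissible k → Monomial B d → Monomial B (generator k ℤ.* d)
monomial-* {B} k k≤B adm (v , d≡ , supp) = raise i v ,
  trans (cong₂ ℤ._*_ (cong generator (sym toℕ-i)) d≡) (sym (∏-raise (generator ∘ toℕ) i v)) ,
  λ l ne → [ (λ { refl → subst Admissible (sym toℕ-i) adm }) , supp l ]′ (raise-support i v ne)
  where
  i : Fin (suc B)
  i = fromℕ< (s≤s k≤B)
  toℕ-i : toℕ i ≡ k
  toℕ-i = Fin.toℕ-fromℕ< (s≤s k≤B)

generator-prime : ∀ {p} → Prime p → generator p ≡ + p
generator-prime {zero}  pr = contradiction pr ¬prime[0]
generator-prime {suc p} pr = refl

monomial-product : ∀ {B} ps → All Prime ps → 0 < B → product ps ≤ B → ¬ (3 ℕ∣ product ps) → Monomial B (+ product ps)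
monomial-product {B} [] _ _ _ _ = monomial-1 B
monomial-product (p ∷ ps) (pr ∷ prs) 0<B le 3∤ =
  subst (Monomial _) (trans (cong (ℤ._* + product ps) (generator-prime pr)) (sym (ℤ.pos-* p (product ps))))
    (monomial-* p (ℕ.≤-trans (ℕ.m≤m*n p (product ps)) le)
      (inj₂ (pr , λ p≡3 → 3∤ (subst (_ℕ∣ p * product ps) p≡3 (ℕD.m∣m*n (product ps)))))
      (monomial-product ps prs 0<B (ℕ.≤-trans (ℕ.m≤n*m (product ps) p) le) (λ 3∣ → 3∤ (ℕD.∣n⇒∣m*n p 3∣))))
  where
  instance
    p≢0 = prime⇒nonZero pr
    ps≢0 = productOfPrimes≢0 prs

-- The discriminant is d or 4 d. With m = 3 this carries the hypothesis on discriminants over to the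
-- square-free part d.
quadDisc-∣ : ∀ m d → m ∣ d → m ∣ quadDisc d
quadDisc-∣ m d m∣d with ∣ d ℤ.- + 1 ∣ % 4
... | zero  = m∣d
... | suc _ = subst (∣ m ∣ ℕ∣_) (sym (ℤ.abs-* (+ 4) d)) (ℕD.∣n⇒∣m*n 4 m∣d)

monomial-squarefree : ∀ {B} d → 0 < ∣ d ∣ → ∣ d ∣ ≤ B → ¬ (3 ℕ∣ ∣ d ∣) → Monomial B d
monomial-squarefree {B} (+ d) 0<d d≤B 3∤d with record { factors = ps ; isFactorisation = refl ; factorsPrime = prs } ← factorise d {{ℕ.>-nonZero 0<d}} =
  monomial-product ps prs (ℕ.<-≤-trans 0<d d≤B) d≤B 3∤d
monomial-squarefree {B} -[1+ d ] 0<d d≤B 3∤d =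
  subst (Monomial B) (ℤ.-1*i≡-i (+ suc d)) (monomial-* 0 z≤n (inj₁ refl) (monomial-squarefree (+ suc d) 0<d d≤B 3∤d))

record SquareTimesMonomial (B : ℕ) (g : ℤ) : Set where
  field
    root       : ℤ
    exponent   : Fin (suc B) → ℕ
    equality   : g ≡ root ℤ.* root ℤ.* monomial exponent
    admissible : ∀ k → exponent k ≢ 0 → Admissible (toℕ k)

square-times-squarefree : ∀ g → g ≢ + 0 → Σ ℤ λ f → Σ ℤ λ d → (g ≡ f ℤ.* f ℤ.* d) × SquareFree d
square-times-squarefree (+ zero)  g≢0 = contradiction refl g≢0
square-times-squarefree (+ suc n) _ with f , d , eq , sf ← squarefree-part (suc n) (s≤s z≤n) =
  + f , + d , trans (cong +_ eq) (trans (ℤ.pos-* (f * f) d) (cong (ℤ._* + d) (ℤ.pos-* f f))) , sf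
square-times-squarefree -[1+ n ]  _ with f , d , eq , sf ← square-times-squarefree (+ suc n) (λ ()) =
  f , ℤ.- d , trans (cong ℤ.-_ eq) (ℤ.neg-distribʳ-* (f ℤ.* f) d) , λ m m²∣d → sf m (subst (m * m ℕ∣_) (ℤ.∣-i∣≡∣i∣ d) m²∣d)

-- The prime 3 may divide g through the square factor, which a quadratic character does not see;
-- only the square-free part has to avoid it.
square-times-monomial : ∀ {B} g → g ≢ + 0 → ∣ g ∣ ≤ B → (∀ D → IsDiscOfQSqrt g D → ¬ ((+ 3) ∣ D)) → SquareTimesMonomial B g
square-times-monomial {B} g g≢0 g≤B disc with f , d , g≡f²d , sf ← square-times-squarefree g g≢0 =
  record { root = f ; exponent = proj₁ d-monomial ; equality = trans g≡f²d (cong (f ℤ.* f ℤ.*_) (proj₁ (proj₂ d-monomial))) ; admissible = proj₂ (proj₂ d-monomial) }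
  where
  instance
    ∣g∣≢0 : NonZero ∣ g ∣
    ∣g∣≢0 = ℕ.≢-nonZero (g≢0 ∘ ℤ.∣i∣≡0⇒i≡0)
  ∣g∣≡ : ∣ g ∣ ≡ ∣ f ℤ.* f ∣ * ∣ d ∣
  ∣g∣≡ = trans (cong ∣_∣ g≡f²d) (ℤ.abs-* (f ℤ.* f) d)
  0<d : 0 < ∣ d ∣
  0<d = ℕ.n≢0⇒n>0 λ d≡0 → ℕ.≢-nonZero⁻¹ ∣ g ∣ (trans ∣g∣≡ (trans (cong (∣ f ℤ.* f ∣ *_) d≡0) (ℕ.*-zeroʳ ∣ f ℤ.* f ∣)))
  d≤B : ∣ d ∣ ≤ B
  d≤B = ℕ.≤-trans (ℕD.∣⇒≤ (ℕdivides ∣ f ℤ.* f ∣ ∣g∣≡)) g≤B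
  d-monomial : Monomial B d
  d-monomial = monomial-squarefree d 0<d d≤B λ 3∣d → disc (quadDisc d) (f , d , g≡f²d , sf , refl) (quadDisc-∣ (+ 3) d 3∣d)

-- Characters taking the value -1 at every `g i`

IsSquare-* : ∀ {x y} → IsSquare x → IsSquare y → IsSquare (x ℤ.* y)
IsSquare-* (m , refl) (n , refl) = m ℤ.* n , lemma m n
  where
  lemma : ∀ m n → m ℤ.* m ℤ.* (n ℤ.* n) ≡ m ℤ.* n ℤ.* (m ℤ.* n)
  lemma = solve-∀

IsSquare-∏ : ∀ {n} {f : Fin n → ℤ} → (∀ i → IsSquare (f i)) → IsSquare (∏.sum f)
IsSquare-∏ {zero}  sq = + 1 , refl
IsSquare-∏ {suc n} sq = IsSquare-* (sq zero) (IsSquare-∏ (sq ∘ suc))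

IsSquare-^ : ∀ a n → parity n ≡ 0ℙ → IsSquare (a ℤ.^ n)
IsSquare-^ a zero          _    = + 1 , refl
IsSquare-^ a (suc (suc n)) even = subst IsSquare (ℤ.*-assoc a a (a ℤ.^ n)) (IsSquare-* {a ℤ.* a} (a , refl) (IsSquare-^ a n even))

∏ℤ≡∏ : ∀ k (f : Fin k → ℤ) → ∏ℤ k f ≡ ∏.sum f
∏ℤ≡∏ zero    f = refl
∏ℤ≡∏ (suc k) f = cong (f zero ℤ.*_) (∏ℤ≡∏ k (f ∘ suc))

parity-∑ℕ : ∀ k f → parity (∑ℕ k f) ≡ ∑ℙ.sum (parity ∘ f)
parity-∑ℕ zero    f = refl
parity-∑ℕ (suc k) f = trans (ℙ.+-homo-+ (f zero) _) (cong (parity (f zero) ℙ.+_) (parity-∑ℕ k (f ∘ suc)))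

∏-^ : ∀ {n} (f : Fin n → ℤ) m → ∏.sum f ℤ.^ m ≡ ∏.sum (λ i → f i ℤ.^ m)
∏-^ {zero}  f m = ℤ.^-zeroˡ m
∏-^ {suc n} f m = trans (^-*-distrib (f zero) _ m) (cong (f zero ℤ.^ m ℤ.*_) (∏-^ (f ∘ suc) m))

∏-^-∑ : ∀ k a (n : Fin k → ℕ) → ∏.sum (λ i → a ℤ.^ n i) ≡ a ℤ.^ ∑ℕ k n
∏-^-∑ zero    a n = refl
∏-^-∑ (suc k) a n = trans (cong (a ℤ.^ n zero ℤ.*_) (∏-^-∑ k a (n ∘ suc))) (sym (ℤ.^-distribˡ-+-* a (n zero) _))

odd⇒%2≡1 : ∀ n → parity n ≡ 1ℙ → n % 2 ≡ 1
odd⇒%2≡1 (suc zero)    _ = refl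
odd⇒%2≡1 (suc (suc n)) o = trans (+2-%2 n) (odd⇒%2≡1 n o)
  where
  +2-%2 : ∀ n → suc (suc n) % 2 ≡ n % 2
  +2-%2 n = trans (cong (_% 2) (ℕ.+-comm 2 n)) ([m+n]%n≡m%n n 2)

exponent : Parity → Fin 2
exponent 0ℙ = zero
exponent 1ℙ = suc zero

parity-exponent : ∀ a → parity (toℕ (exponent a)) ≡ a
parity-exponent 0ℙ = refl
parity-exponent 1ℙ = refl

module _ {B s : ℕ} (g : Fin s → ℤ) (R : ∀ i → SquareTimesMonomial B (g i)) where
  open module R i = SquareTimesMonomial (R i) using (root) renaming (exponent to v)

  -- After the two products are exchanged, generator k carries the exponent Σ `v i k * e i`, even by
  -- hypothesis; the roots contribute squares in any case.
  square-product : (e : Fin s → ℕ) → (∀ k → ∑ℙ.sum (λ i → parity (e i) ℙ.* parity (v i k)) ≡ 0ℙ) →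
                   IsSquare (∏ℤ s (λ i → g i ℤ.^ e i))
  square-product e even = subst IsSquare (sym (begin
    ∏ℤ s (λ i → g i ℤ.^ e i)
      ≡⟨ ∏ℤ≡∏ s _ ⟩
    ∏.sum (λ i → g i ℤ.^ e i)
      ≡⟨ ∏.sum-cong-≗ (λ i → trans (cong (ℤ._^ e i) (R.equality i)) (^-*-distrib (root i ℤ.* root i) (monomial (v i)) (e i))) ⟩
    ∏.sum (λ i → (root i ℤ.* root i) ℤ.^ e i ℤ.* monomial (v i) ℤ.^ e i)
      ≡⟨ ∏.∑-distrib-+ (λ i → (root i ℤ.* root i) ℤ.^ e i) (λ i → monomial (v i) ℤ.^ e i) ⟩
    squares ℤ.* ∏.sum (λ i → monomial (v i) ℤ.^ e i)
      ≡⟨ cong (squares ℤ.*_) (∏.sum-cong-≗ (λ i → trans (∏-^ (λ k → generator (toℕ k) ℤ.^ v i k) (e i)) (∏.sum-cong-≗ {suc B} (λ k → ℤ.^-*-assoc (generator (toℕ k)) (v i k) (e i))))) ⟩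
    squares ℤ.* ∏.sum (λ i → ∏.sum {suc B} (λ k → generator (toℕ k) ℤ.^ (v i k * e i)))
      ≡⟨ cong (squares ℤ.*_) (trans (∏.∑-comm (λ i (k : Fin (suc B)) → generator (toℕ k) ℤ.^ (v i k * e i)))
           (∏.sum-cong-≗ {suc B} (λ k → ∏-^-∑ s (generator (toℕ k)) (λ i → v i k * e i)))) ⟩
    squares ℤ.* ∏.sum {suc B} (λ k → generator (toℕ k) ℤ.^ ∑ℕ s (λ i → v i k * e i)) ∎))
    (IsSquare-* (IsSquare-∏ (λ i → subst IsSquare (sym (^-*-distrib (root i) (root i) (e i))) (root i ℤ.^ e i , refl)))
                (IsSquare-∏ {suc B} (λ k → IsSquare-^ (generator (toℕ k)) (∑ℕ s (λ i → v i k * e i)) (even-exponent k))))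
    where
    open ≡-Reasoning
    squares = ∏.sum (λ i → (root i ℤ.* root i) ℤ.^ e i)
    even-exponent : ∀ k → parity (∑ℕ s (λ i → v i k * e i)) ≡ 0ℙ
    even-exponent k = trans (parity-∑ℕ s _)
      (trans (∑ℙ.sum-cong-≗ (λ i → trans (ℙ.*-homo-* (v i k) (e i)) (ℙ.*-comm (parity (v i k)) (parity (e i))))) (even k))

  -- `φ k` is the desired character at generator k. The right-hand side of the system is constantly
  -- 1, so the second half of an obstruction says that an odd number of the `g i` is selected.
  nonresidue-character :
    (∀ (e : Fin s → Fin 2) → ∑ℕ s (λ i → toℕ (e i)) % 2 ≡ 1 → ¬ IsSquare (∏ℤ s (λ i → g i ℤ.^ toℕ (e i)))) →
    Σ (Fin (suc B) → Parity) λ φ → ∀ i → ∑ℙ.sum (λ k → parity (v i k) ℙ.* φ k) ≡ 1ℙ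
  nonresidue-character not-square with fredholm (suc B) (λ i k → parity (v i k)) (λ _ → 1ℙ)
  ... | inj₁ solution = solution
  ... | inj₂ (e , relation , e-odd) = contradiction
    (square-product (toℕ ∘ exponent ∘ e) λ k →
      trans (∑ℙ.sum-cong-≗ (λ i → cong (ℙ._* parity (v i k)) (parity-exponent (e i)))) (relation k))
    (not-square (exponent ∘ e) (odd⇒%2≡1 (∑ℕ s (toℕ ∘ exponent ∘ e)) (trans (parity-∑ℕ s (toℕ ∘ exponent ∘ e))
      (trans (∑ℙ.sum-cong-≗ (λ i → trans (parity-exponent (e i)) (sym (ℙ.*-identityʳ (e i))))) e-odd))))

monomial-^ : ∀ {m n h} (v : Fin n → ℕ) (φ : Fin n → Parity) →
             (∀ k → v k ≢ 0 → generator (toℕ k) ℤ.^ h ≋ sgn (φ k) [mod m ]) →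
             monomial v ℤ.^ h ≋ sgn (∑ℙ.sum (λ k → parity (v k) ℙ.* φ k)) [mod m ]
monomial-^ {m} {n} {h} v φ values = begin
  monomial v ℤ.^ h                                      ≈⟨ ≋-reflexive (∏-^ (λ k → generator (toℕ k) ℤ.^ v k) h) ⟩
  ∏.sum (λ k → (generator (toℕ k) ℤ.^ v k) ℤ.^ h)       ≈⟨ ≋-∏ factor ⟩
  ∏.sum (λ k → sgn (parity (v k) ℙ.* φ k))              ≈⟨ ≋-reflexive (sgn-∑ (λ k → parity (v k) ℙ.* φ k)) ⟩
  sgn (∑ℙ.sum (λ k → parity (v k) ℙ.* φ k))             ∎
  where
  open ≋-Reasoning m
  ^-swap : ∀ a i j → (a ℤ.^ i) ℤ.^ j ≡ (a ℤ.^ j) ℤ.^ i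
  ^-swap a i j = trans (ℤ.^-*-assoc a i j) (trans (cong (a ℤ.^_) (ℕ.*-comm i j)) (sym (ℤ.^-*-assoc a j i)))
  factor : ∀ k → (generator (toℕ k) ℤ.^ v k) ℤ.^ h ≋ sgn (parity (v k) ℙ.* φ k) [mod m ]
  factor k with v k ℕ.≟ 0
  ... | yes vₖ≡0 rewrite vₖ≡0 = ≋-reflexive (ℤ.^-zeroˡ h)
  ... | no  vₖ≢0 = ≋-trans (≋-reflexive (^-swap (generator (toℕ k)) (v k) h))
                     (≋-trans (≋-^ (v k) (values k vₖ≢0)) (≋-reflexive (sgn-^ (φ k) (v k))))

square-times-monomial-^ : ∀ {B g} (R : SquareTimesMonomial B g) (φ : Fin (suc B) → Parity)
  h (pr : Prime (suc (h + h))) → ¬ (g ≋ + 0 [mod suc (h + h) ]) →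
  (∀ k → Admissible (toℕ k) → generator (toℕ k) ℤ.^ h ≋ sgn (φ k) [mod suc (h + h) ]) →
  g ℤ.^ h ≋ sgn (∑ℙ.sum (λ k → parity (SquareTimesMonomial.exponent R k) ℙ.* φ k)) [mod suc (h + h) ]
square-times-monomial-^ {B} {g} R φ h pr g≢0 values = begin
  g ℤ.^ h                                             ≈⟨ ≋-reflexive (trans (cong (ℤ._^ h) equality) (^-*-distrib (root ℤ.* root) (monomial v) h)) ⟩
  (root ℤ.* root) ℤ.^ h ℤ.* monomial v ℤ.^ h          ≈⟨ ≋-* root-^ (monomial-^ {h = h} v φ (λ k vₖ≢0 → values k (admissible k vₖ≢0))) ⟩
  + 1 ℤ.* sgn (∑ℙ.sum (λ k → parity (v k) ℙ.* φ k))   ≈⟨ ≋-reflexive (ℤ.*-identityˡ _) ⟩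
  sgn (∑ℙ.sum (λ k → parity (v k) ℙ.* φ k))           ∎
  where
  open ≋-Reasoning (suc (h + h))
  open SquareTimesMonomial R renaming (exponent to v)
  root≢0 : ¬ (root ≋ + 0 [mod suc (h + h) ])
  root≢0 e = g≢0 (≋-trans (≋-reflexive equality) (≋-trans (≋-* (≋-* e e) (≋-refl {a = monomial v})) (≋-reflexive (ℤ.*-zeroˡ (monomial v)))))
  root-^ : (root ℤ.* root) ℤ.^ h ≋ + 1 [mod suc (h + h) ]
  root-^ = ≋-trans (≋-reflexive (trans (^-*-distrib root root h) (sym (ℤ.^-distribˡ-+-* root h h)))) (GaussLemma.fermat h pr root root≢0)

-- Residue classes that prescribe the characters

halves : ∀ n → Σ ℕ λ k → n ≡ k + k ⊎ n ≡ suc (k + k)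
halves zero = 0 , inj₁ refl
halves (suc n) with halves n
... | k , inj₁ refl = k , inj₂ refl
... | k , inj₂ refl = suc k , inj₁ (cong suc (sym (ℕ.+-suc k k)))

odd-prime : ∀ {p} → Prime p → p ≢ 2 → Σ ℕ λ k → p ≡ suc (k + k)
odd-prime {p} pr p≢2 with halves p
... | k , inj₂ eq = k , eq
... | k , inj₁ eq with prime⇒irreducible pr (ℕdivides k (trans eq (trans (cong (λ z → k + z) (sym (ℕ.+-identityʳ k))) (ℕ.*-comm 2 k))))
...   | inj₁ ()
...   | inj₂ 2≡p = contradiction (sym 2≡p) p≢2

-- Values of h = (p - 1) / 2 modulo 8. The arguments are the parities of h and of 1 + ... + h, which
-- decide (-1 | p) and (2 | p). When both are even, 4 is taken rather than 0, so that the power of 2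
-- in p - 1 is known.
half : Parity → Parity → ℕ
half 1ℙ 1ℙ = 1
half 1ℙ 0ℙ = 3
half 0ℙ 1ℙ = 2
half 0ℙ 0ℙ = 4

-- A prime in this class modulo 16 gives (-1|p) = sgn a and (2|p) = sgn b, while
-- p - 1 is an odd multiple of 2, 4 or 8.
class₁₆ : Parity → Parity → ℕ
class₁₆ a b = suc (half a b + half a b)

class₁₆<16 : ∀ a b → class₁₆ a b < 16
class₁₆<16 1ℙ 1ℙ = ℕ.m<m+n 3 (s≤s z≤n)
class₁₆<16 1ℙ 0ℙ = ℕ.m<m+n 7 (s≤s z≤n)
class₁₆<16 0ℙ 1ℙ = ℕ.m<m+n 5 (s≤s z≤n)
class₁₆<16 0ℙ 0ℙ = ℕ.m<m+n 9 (s≤s z≤n)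

class₁₆-half : ∀ a b h → + suc (h + h) ≋ + class₁₆ a b [mod 16 ] → Σ ℕ λ u → h ≡ u * 8 + half a b
class₁₆-half a b h e = u , ℕ.*-cancelˡ-≡ h (u * 8 + half a b) 2 (ℕ.suc-injective (begin
  suc (2 * h)                        ≡⟨ cong suc (cong (λ z → h + z) (ℕ.+-identityʳ h)) ⟩
  suc (h + h)                        ≡⟨ m≡m%n+[m/n]*n (suc (h + h)) 16 ⟩
  suc (h + h) % 16 + u * 16          ≡⟨ cong (_+ u * 16) (≋-small (≋-trans (≋-sym (≋-% (suc (h + h)) 16)) e) (m%n<n (suc (h + h)) 16) (class₁₆<16 a b)) ⟩
  suc (half a b + half a b) + u * 16 ≡⟨ cong suc (lemma (half a b) u) ⟩
  suc (2 * (u * 8 + half a b))       ∎))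
  where
  open ≡-Reasoning
  u = suc (h + h) / 16
  lemma : ∀ t u → t + t + u * 16 ≡ 2 * (u * 8 + t)
  lemma = ℕSolver.solve-∀

parity-half : ∀ a b u → parity (u * 8 + half a b) ≡ a
parity-half 1ℙ 1ℙ zero = refl
parity-half 1ℙ 0ℙ zero = refl
parity-half 0ℙ 1ℙ zero = refl
parity-half 0ℙ 0ℙ zero = refl
parity-half a b (suc u) = parity-half a b u

-- Raising h by 8 adds eight terms of which four are odd; the four inversions of the parity cancel
-- in pairs.
∑-parity-half : ∀ a b u → ∑ℙ.sum {u * 8 + half a b} (λ x → parity (suc (toℕ x))) ≡ b
∑-parity-half 1ℙ 1ℙ zero = refl
∑-parity-half 1ℙ 0ℙ zero = refl
∑-parity-half 0ℙ 1ℙ zero = refl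
∑-parity-half 0ℙ 0ℙ zero = refl
∑-parity-half a b (suc u) = trans (ℙ.⁻¹-involutive _) (trans (ℙ.⁻¹-involutive _) (∑-parity-half a b u))

class₁₆-parities : ∀ a b h → + suc (h + h) ≋ + class₁₆ a b [mod 16 ] →
                   parity h ≡ a × ∑ℙ.sum {h} (λ x → parity (suc (toℕ x))) ≡ b
class₁₆-parities a b h e = from-half (class₁₆-half a b h e)
  where
  from-half : (Σ ℕ λ u → h ≡ u * 8 + half a b) → parity h ≡ a × ∑ℙ.sum {h} (λ x → parity (suc (toℕ x))) ≡ b
  from-half (u , refl) = parity-half a b u , ∑-parity-half a b u

-- By reciprocity this is the condition modulo l under which a prime p ≡ c with
-- (-1|p) = sgn (ψ 0) has (l|p) = sgn (ψ l); it also keeps p and p - 1 prime to l.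
LocalCondition : (ℕ → Parity) → ℕ → ℕ → Set
LocalCondition ψ l c = ¬ (+ c ≋ + 0 [mod l ]) × ¬ (+ c ≋ + 1 [mod l ]) ×
  (∀ k → l ≡ suc (k + k) → l ≢ 3 → (+ c) ℤ.^ k ≋ sgn (ψ l ℙ.+ (parity k ℙ.* ψ 0)) [mod l ])

localCondition-cong : ∀ {ψ l c d} → + c ≋ + d [mod l ] → LocalCondition ψ l d → LocalCondition ψ l c
localCondition-cong e (d≢0 , d≢1 , value) =
  (λ c≋0 → d≢0 (≋-trans (≋-sym e) c≋0)) , (λ c≋1 → d≢1 (≋-trans (≋-sym e) c≋1)) ,
  λ k l≡ l≢3 → ≋-trans (≋-^ k e) (value k l≡ l≢3)

halves-injective : ∀ k k′ → suc (k + k) ≡ suc (k′ + k′) → k ≡ k′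
halves-injective k k′ eq = ℕ.*-cancelˡ-≡ k k′ 2 (trans (cong (λ z → k + z) (ℕ.+-identityʳ k)) (trans (ℕ.suc-injective eq) (cong (λ z → k′ + z) (sym (ℕ.+-identityʳ k′)))))

localCondition-solution : ∀ ψ {l} → Prime l → l ≢ 2 → Σ ℕ (LocalCondition ψ l)
localCondition-solution ψ pr l≢2 with odd-prime pr l≢2
... | zero , refl = contradiction pr ¬prime[1]
... | suc zero , refl = 2 , (λ e → contradiction (≋0-small e (ℕ.n<1+n 2)) λ ()) ,
        (λ e → contradiction (≋-small e (ℕ.n<1+n 2) (s≤s (s≤s z≤n))) λ ()) , λ _ _ 3≢3 → contradiction refl 3≢3
... | k@(suc (suc _)) , refl
  with c , c≢0 , c≢1 , value ← character-value k pr (s≤s (s≤s z≤n)) (ψ (suc (k + k)) ℙ.+ (parity k ℙ.* ψ 0)) =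
  c , c≢0 , c≢1 , λ k′ eq _ → subst (λ k′ → (+ c) ℤ.^ k′ ≋ sgn (ψ (suc (k + k)) ℙ.+ (parity k′ ℙ.* ψ 0)) [mod _ ]) (halves-injective k k′ eq) value

module _ (ψ : ℕ → Parity) (h : ℕ) (pr : Prime (suc (h + h))) where
  open GaussLemma h pr

  private
    2<p : 2 < p
    2<p = s≤s (ℕ.+-mono-≤ (half>0 h pr) (half>0 h pr))

  -1-value : parity h ≡ ψ 0 → generator 0 ℤ.^ h ≋ sgn (ψ 0) [mod p ]
  -1-value eq = ≋-reflexive (trans (sgn-^ 1ℙ h) (cong sgn (trans (ℙ.*-identityʳ (parity h)) eq)))

  2-value : ∑ℙ.sum {h} (λ x → parity (suc (toℕ x))) ≡ ψ 2 → generator 2 ℤ.^ h ≋ sgn (ψ 2) [mod p ]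
  2-value eq = ≋-trans (gauss 2 2≢0) (≋-reflexive (cong sgn (trans (gaussSign-2 2≢0) eq)))
    where
    2≢0 : ¬ (+ 2 ≋ + 0 [mod p ])
    2≢0 e = contradiction (≋0-small e 2<p) λ ()

  -- Reciprocity carries the sign `parity h ℙ.* parity k`. As `parity h` is `ψ 0`, this is the term
  -- `parity k ℙ.* ψ 0` built into `LocalCondition`, and the two cancel.
  odd-value : ∀ k → Prime (suc (k + k)) → suc (k + k) ≢ 3 → suc (k + k) < p → parity h ≡ ψ 0 →
              LocalCondition ψ (suc (k + k)) p → generator (suc (k + k)) ℤ.^ h ≋ sgn (ψ (suc (k + k))) [mod p ]
  odd-value k l-prime l≢3 l<p h≡ψ0 (p≢0 , _ , value) = ≋-trans (gauss l l≢0) (≋-reflexive (cong sgn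
    (solve-for (gaussSign l l≢0) (ψ l) (parity k ℙ.* ψ 0) (begin
      gaussSign l l≢0 ℙ.+ (ψ l ℙ.+ (parity k ℙ.* ψ 0))    ≡⟨ cong (gaussSign l l≢0 ℙ.+_) (sym p-sign) ⟩
      gaussSign l l≢0 ℙ.+ Gl.gaussSign p p≢0              ≡⟨ quadratic-reciprocity h k pr l-prime l≢0 p≢0 ⟩
      parity h ℙ.* parity k                               ≡⟨ trans (ℙ.*-comm (parity h) (parity k)) (cong (parity k ℙ.*_) h≡ψ0) ⟩
      parity k ℙ.* ψ 0                                    ∎))))
    where
    open ≡-Reasoning
    module Gl = GaussLemma k l-prime
    l = suc (k + k)
    l≢0 : ¬ (+ l ≋ + 0 [mod p ])
    l≢0 e = contradiction (≋0-small e l<p) λ ()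
    p-sign : Gl.gaussSign p p≢0 ≡ ψ l ℙ.+ (parity k ℙ.* ψ 0)
    p-sign = sgn-≋-injective (s≤s (ℕ.+-mono-≤ (half>0 k l-prime) (half>0 k l-prime))) _ _
      (≋-trans (≋-sym (Gl.gauss p p≢0)) (value k refl l≢3))
    solve-for : ∀ x y z → x ℙ.+ (y ℙ.+ z) ≡ z → x ≡ y
    solve-for 0ℙ 0ℙ _  _ = refl
    solve-for 1ℙ 1ℙ _  _ = refl
    solve-for 0ℙ 1ℙ 0ℙ ()
    solve-for 0ℙ 1ℙ 1ℙ ()
    solve-for 1ℙ 0ℙ 0ℙ ()
    solve-for 1ℙ 0ℙ 1ℙ ()

  generator-values : ∀ {B} → B < p → parity h ≡ ψ 0 → ∑ℙ.sum {h} (λ x → parity (suc (toℕ x))) ≡ ψ 2 →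
    (∀ l → Prime l → l ≢ 2 → l ≤ B → LocalCondition ψ l p) →
    ∀ k → k ≤ B → Admissible k → generator k ℤ.^ h ≋ sgn (ψ k) [mod p ]
  generator-values B<p h≡ψ0 ∑≡ψ2 local k k≤B (inj₁ refl) = -1-value h≡ψ0
  generator-values B<p h≡ψ0 ∑≡ψ2 local k k≤B (inj₂ (k-prime , k≢3)) = by-parity (k ℕ.≟ 2)
    where
    at-odd : ∀ j → k ≡ suc (j + j) → k ≢ 2 → generator k ℤ.^ h ≋ sgn (ψ k) [mod p ]
    at-odd j refl k≢2 = odd-value j k-prime k≢3 (ℕ.≤-<-trans k≤B B<p) h≡ψ0 (local _ k-prime k≢2 k≤B)
    by-parity : Dec (k ≡ 2) → generator k ℤ.^ h ≋ sgn (ψ k) [mod p ]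
    by-parity (yes k≡2) = subst (λ k → generator k ℤ.^ h ≋ sgn (ψ k) [mod p ]) (sym k≡2) (2-value ∑≡ψ2)
    by-parity (no k≢2)  = at-odd (proj₁ (odd-prime k-prime k≢2)) (proj₂ (odd-prime k-prime k≢2)) k≢2

-- The stage reached once the primes up to b have been treated. `prime∣⇒≤` makes the next odd prime
-- coprime to the modulus, as the Chinese remainder theorem requires, and later makes the slopes of
-- the linear forms units modulo the primes above b.
record ResidueClass (ψ : ℕ → Parity) (b : ℕ) : Set where
  field
    modulus representative : ℕ
    modulus>0    : 0 < modulus
    16∣modulus   : 16 ℕ∣ modulus
    class        : + representative ≋ + class₁₆ (ψ 0) (ψ 2) [mod 16 ]
    prime∣       : ∀ {l} → Prime l → l ≢ 2 → l ≤ b → l ℕ∣ modulus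
    local        : ∀ {l} → Prime l → l ≢ 2 → l ≤ b → LocalCondition ψ l representative
    prime∣⇒≤     : ∀ {l} → Prime l → l ℕ∣ modulus → l ≡ 2 ⊎ l ≤ b

∣2^⇒≡2 : ∀ n {l} → Prime l → l ℕ∣ 2 ℕ.^ n → l ≡ 2
∣2^⇒≡2 zero pr l∣1 = contradiction (subst Prime (ℕD.∣1⇒≡1 l∣1) pr) ¬prime[1]
∣2^⇒≡2 (suc n) {l} pr l∣ with euclidsLemma 2 (2 ℕ.^ n) pr l∣
... | inj₂ l∣2^n = ∣2^⇒≡2 n pr l∣2^n
... | inj₁ l∣2 with prime⇒irreducible prime[2] l∣2
...   | inj₁ l≡1 = contradiction (subst Prime l≡1 pr) ¬prime[1]
...   | inj₂ l≡2 = l≡2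

chinese-remainder : ∀ {q M} .{{_ : NonZero q}} → Coprime q M → ∀ c t → Σ ℕ λ d → (+ d ≋ + c [mod M ]) × (+ d ≋ + t [mod q ])
chinese-remainder {q} {M} co c t with z , Mz≋1 ← coprime⇒inverse co = c + w * M , congruent (+ w) d≡ , (begin
    + (c + w * M)                             ≈⟨ ≋-reflexive d≡ ⟩
    + c ℤ.+ + w ℤ.* + M                       ≈⟨ ≋-+ (≋-refl {a = + c}) (≋-* (≋-sym (≋-%ℕ (z ℤ.* (+ t ℤ.- + c)) q)) (≋-refl {a = + M})) ⟩
    + c ℤ.+ z ℤ.* (+ t ℤ.- + c) ℤ.* + M       ≈⟨ ≋-reflexive (lemma (+ c) z (+ t) (+ M)) ⟩
    + c ℤ.+ + M ℤ.* z ℤ.* (+ t ℤ.- + c)       ≈⟨ ≋-+ (≋-refl {a = + c}) (≋-* Mz≋1 (≋-refl {a = + t ℤ.- + c})) ⟩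
    + c ℤ.+ + 1 ℤ.* (+ t ℤ.- + c)             ≈⟨ ≋-reflexive (lemma′ (+ c) (+ t)) ⟩
    + t                                       ∎)
  where
  open ≋-Reasoning q
  w : ℕ
  w = (z ℤ.* (+ t ℤ.- + c)) %ℕ q
  d≡ : + (c + w * M) ≡ + c ℤ.+ + w ℤ.* + M
  d≡ = cong (λ x → + c ℤ.+ x) (ℤ.pos-* w M)
  lemma : ∀ c z t M → c ℤ.+ z ℤ.* (t ℤ.- c) ℤ.* M ≡ c ℤ.+ M ℤ.* z ℤ.* (t ℤ.- c)
  lemma = solve-∀
  lemma′ : ∀ c t → c ℤ.+ + 1 ℤ.* (t ℤ.- c) ≡ t
  lemma′ = solve-∀

residueClass-0 : ∀ ψ → ResidueClass ψ 0
residueClass-0 ψ = record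
  { modulus = 16
  ; representative = class₁₆ (ψ 0) (ψ 2)
  ; modulus>0 = s≤s z≤n
  ; 16∣modulus = ℕD.∣-refl
  ; class = ≋-refl
  ; prime∣ = λ { pr _ z≤n → contradiction pr ¬prime[0] }
  ; local = λ { pr _ z≤n → contradiction pr ¬prime[0] }
  ; prime∣⇒≤ = λ pr l∣16 → inj₁ (∣2^⇒≡2 4 pr l∣16)
  }

residueClass-skip : ∀ {ψ b} → ResidueClass ψ b → (Prime (suc b) → suc b ≡ 2) → ResidueClass ψ (suc b)
residueClass-skip {ψ} {b} R not-odd-prime = record
  { modulus = modulus
  ; representative = representative
  ; modulus>0 = modulus>0
  ; 16∣modulus = 16∣modulus
  ; class = class
  ; prime∣ = λ pr l≢2 l≤1+b → prime∣ pr l≢2 (below pr l≢2 l≤1+b)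
  ; local = λ pr l≢2 l≤1+b → local pr l≢2 (below pr l≢2 l≤1+b)
  ; prime∣⇒≤ = λ pr l∣M → [ inj₁ , (λ l≤b → inj₂ (ℕ.m≤n⇒m≤1+n l≤b)) ]′ (prime∣⇒≤ pr l∣M)
  }
  where
  open ResidueClass R
  below : ∀ {l} → Prime l → l ≢ 2 → l ≤ suc b → l ≤ b
  below pr l≢2 l≤1+b = ℕ.≤-pred (ℕ.≤∧≢⇒< l≤1+b λ { refl → l≢2 (not-odd-prime pr) })

residueClass-refine : ∀ {ψ b} → ResidueClass ψ b → Prime (suc b) → suc b ≢ 2 → ResidueClass ψ (suc b)
residueClass-refine {ψ} {b} R q-prime q≢2
  with t , t-local ← localCondition-solution ψ q-prime q≢2
  with d , d≋c , d≋t ← chinese-remainder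
         (prime-coprime q-prime λ q∣M → [ q≢2 , ℕ.1+n≰n ]′ (ResidueClass.prime∣⇒≤ R q-prime q∣M)) (ResidueClass.representative R) t = record
  { modulus = modulus * suc b
  ; representative = d
  ; modulus>0 = ℕ.*-mono-≤ modulus>0 (s≤s z≤n)
  ; 16∣modulus = ℕD.∣m⇒∣m*n (suc b) 16∣modulus
  ; class = ≋-trans (≋-∣ 16∣modulus d≋c) class
  ; prime∣ = λ {l} → prime∣′ {l}
  ; local = λ {l} → local′ {l}
  ; prime∣⇒≤ = λ {l} → prime∣⇒≤′ {l}
  }
  where
  open ResidueClass R
  below : ∀ {l} → l ≤ suc b → l ≢ suc b → l ≤ b
  below l≤q l≢q = ℕ.≤-pred (ℕ.≤∧≢⇒< l≤q l≢q)
  prime∣′ : ∀ {l} → Prime l → l ≢ 2 → l ≤ suc b → l ℕ∣ modulus * suc b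
  prime∣′ {l} pr l≢2 l≤q with l ℕ.≟ suc b
  ... | yes refl = ℕD.n∣m*n modulus
  ... | no l≢q   = ℕD.∣m⇒∣m*n (suc b) (prime∣ pr l≢2 (below l≤q l≢q))
  local′ : ∀ {l} → Prime l → l ≢ 2 → l ≤ suc b → LocalCondition ψ l d
  local′ {l} pr l≢2 l≤q with l ℕ.≟ suc b
  ... | yes refl = localCondition-cong {ψ} {l} {d} {t} d≋t t-local
  ... | no l≢q   = localCondition-cong {ψ} {l} {d} (≋-∣ (prime∣ pr l≢2 (below l≤q l≢q)) d≋c) (local pr l≢2 (below l≤q l≢q))
  prime∣⇒≤′ : ∀ {l} → Prime l → l ℕ∣ modulus * suc b → l ≡ 2 ⊎ l ≤ suc b
  prime∣⇒≤′ pr l∣ with euclidsLemma modulus (suc b) pr l∣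
  ... | inj₁ l∣M = [ inj₁ , (λ l≤b → inj₂ (ℕ.m≤n⇒m≤1+n l≤b)) ]′ (prime∣⇒≤ pr l∣M)
  ... | inj₂ l∣q = inj₂ (ℕD.∣⇒≤ l∣q)

residueClass : ∀ ψ b → ResidueClass ψ b
residueClass ψ zero = residueClass-0 ψ
residueClass ψ (suc b) with prime? (suc b) | suc b ℕ.≟ 2
... | yes q-prime | no q≢2  = residueClass-refine (residueClass ψ b) q-prime q≢2
... | yes _       | yes q≡2 = residueClass-skip (residueClass ψ b) (λ _ → q≡2)
... | no ¬prime   | _       = residueClass-skip (residueClass ψ b) (λ q-prime → contradiction q-prime ¬prime)

-- Primitive roots modulo p = 1 + 2 ^ suc e * q

^-≋0 : ∀ {m a n} → 0 < n → a ≋ + 0 [mod m ] → a ℤ.^ n ≋ + 0 [mod m ]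
^-≋0 {a = a} {suc n} _ e = ≋-trans (≋-* e (≋-refl {a = a ℤ.^ n})) (≋-reflexive (ℤ.*-zeroˡ (a ℤ.^ n)))

odd∣2^⇒≡1 : ∀ n {x} → ¬ (2 ℕ∣ x) → x ℕ∣ 2 ℕ.^ n → x ≡ 1
odd∣2^⇒≡1 zero    2∤x x∣1 = ℕD.∣1⇒≡1 x∣1
odd∣2^⇒≡1 (suc n) 2∤x x∣  = odd∣2^⇒≡1 n 2∤x (coprime-divisor (Coprimality.sym (prime-coprime prime[2] 2∤x)) x∣)

∣2^suc : ∀ n {m} → m ℕ∣ 2 ℕ.^ suc n → m ℕ∣ 2 ℕ.^ n ⊎ m ≡ 2 ℕ.^ suc n
∣2^suc n {m} (ℕdivides x eq) with 2 ℕD.∣? x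
... | no 2∤x = inj₂ (sym (trans eq (trans (cong (_* m) (odd∣2^⇒≡1 (suc n) 2∤x (ℕdivides m (trans eq (ℕ.*-comm x m))))) (ℕ.*-identityˡ m))))
... | yes (ℕdivides k refl) = inj₁ (ℕdivides k (ℕ.*-cancelˡ-≡ _ _ 2 (trans eq (lemma k m))))
  where
  lemma : ∀ k m → k * 2 * m ≡ 2 * (k * m)
  lemma = ℕSolver.solve-∀

^≋1-* : ∀ {m a} i j → a ℤ.^ i ≋ + 1 [mod m ] → a ℤ.^ (j * i) ≋ + 1 [mod m ]
^≋1-* {m} {a} i j e = ≋-trans (≋-reflexive (trans (cong (a ℤ.^_) (ℕ.*-comm j i)) (sym (ℤ.^-*-assoc a i j)))) (≋-trans (≋-^ j e) (≋-reflexive (ℤ.^-zeroˡ j)))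

^≋1-∣ : ∀ {m a i j} → i ℕ∣ j → a ℤ.^ i ≋ + 1 [mod m ] → a ℤ.^ j ≋ + 1 [mod m ]
^≋1-∣ {i = i} (ℕdivides k refl) = ^≋1-* i k

^≋1-cancel : ∀ {m a} d k → a ℤ.^ k ≋ + 1 [mod m ] → a ℤ.^ (d + k) ≋ + 1 [mod m ] → a ℤ.^ d ≋ + 1 [mod m ]
^≋1-cancel {m} {a} d k ek edk = ≋-trans (≋-trans (≋-reflexive (sym (ℤ.*-identityʳ (a ℤ.^ d)))) (≋-* (≋-refl {a = a ℤ.^ d}) (≋-sym ek)))
  (≋-trans (≋-reflexive (sym (ℤ.^-distribˡ-+-* a d k))) edk)

-- Bézout in the form d + y j = x i keeps the exponents natural: the factor a ^ (y j) is 1 and drops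
-- out, without an inverse of a.
^≋1-gcd : ∀ {m a i j d} → GCD i j d → a ℤ.^ i ≋ + 1 [mod m ] → a ℤ.^ j ≋ + 1 [mod m ] → a ℤ.^ d ≋ + 1 [mod m ]
^≋1-gcd {m} {a} {i} {j} {d} isGCD ei ej with Bézout.identity isGCD
... | Bézout.+- x y eq = ^≋1-cancel d (y * j) (^≋1-* j y ej) (subst (λ k → a ℤ.^ k ≋ + 1 [mod m ]) (sym eq) (^≋1-* i x ei))
... | Bézout.-+ x y eq = ^≋1-cancel d (x * i) (^≋1-* i x ei) (subst (λ k → a ℤ.^ k ≋ + 1 [mod m ]) (sym eq) (^≋1-* j y ej))

g*g≡∣g∣² : ∀ g → g ℤ.* g ≡ + (∣ g ∣ * ∣ g ∣)
g*g≡∣g∣² (+ n)    = sym (ℤ.pos-* n n)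
g*g≡∣g∣² -[1+ n ] = refl

pos-^ : ∀ a n → (+ a) ℤ.^ n ≡ + (a ℕ.^ n)
pos-^ a zero    = refl
pos-^ a (suc n) = trans (cong (+ a ℤ.*_) (pos-^ a n)) (sym (ℤ.pos-* a (a ℕ.^ n)))

even-^ : ∀ g n → g ℤ.^ (2 * n) ≡ + (∣ g ∣ ℕ.^ (2 * n))
even-^ g n = begin
  g ℤ.^ (2 * n)                    ≡⟨ sym (ℤ.^-*-assoc g 2 n) ⟩
  (g ℤ.* (g ℤ.* + 1)) ℤ.^ n        ≡⟨ cong (ℤ._^ n) (trans (cong (g ℤ.*_) (ℤ.*-identityʳ g)) (g*g≡∣g∣² g)) ⟩
  (+ (∣ g ∣ * ∣ g ∣)) ℤ.^ n        ≡⟨ pos-^ (∣ g ∣ * ∣ g ∣) n ⟩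
  + ((∣ g ∣ * ∣ g ∣) ℕ.^ n)        ≡⟨ cong (λ z → + ((∣ g ∣ * z) ℕ.^ n)) (sym (ℕ.*-identityʳ ∣ g ∣)) ⟩
  + ((∣ g ∣ ℕ.^ 2) ℕ.^ n)          ≡⟨ cong +_ (ℕ.^-*-assoc ∣ g ∣ 2 n) ⟩
  + (∣ g ∣ ℕ.^ (2 * n))            ∎
  where open ≡-Reasoning

-- The order of g divides p - 1 = 2 ^ suc e * q, but neither half of p - 1 nor 2 ^ suc e.
primitive-root : ∀ {e q h g} → Prime (suc (h + h)) → Prime q → h ≡ 2 ℕ.^ e * q →
  1 < ∣ g ∣ → ∣ g ∣ ℕ.^ (2 ℕ.^ suc e) < suc (h + h) → g ℤ.^ h ≋ -[1+ 0 ] [mod suc (h + h) ] →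
  IsPrimitiveRoot g (suc (h + h))
primitive-root {e} {q} {h} {g} p-prime q-prime h≡ 1<g g^D<p g^h≋-1 = g≢0 , ≋⇒CongMod g^2h≋1 , λ k 1≤k k<2h → no-smaller k 1≤k k<2h ∘ CongMod⇒≋ {a = g ℤ.^ k}
  where
  p = suc (h + h)
  D = 2 ℕ.^ suc e
  0<h : 0 < h
  0<h = half>0 h p-prime
  2<p : 2 < p
  2<p = s≤s (ℕ.+-mono-≤ 0<h 0<h)
  g^h≋̸1 : ¬ (g ℤ.^ h ≋ + 1 [mod p ])
  g^h≋̸1 e = contradiction (sgn-≋-injective 2<p 0ℙ 1ℙ (≋-trans (≋-sym e) g^h≋-1)) λ ()
  g≢0 : ¬ ((+ p) ∣ g)
  g≢0 p∣g = 1≋̸0 p-prime (≋-neg (≋-trans (≋-sym g^h≋-1) (^-≋0 0<h (∣⇒≋0 {a = g} p∣g))))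
  g^2h≋1 : g ℤ.^ (h + h) ≋ + 1 [mod p ]
  g^2h≋1 = ≋-trans (≋-reflexive (ℤ.^-distribˡ-+-* g h h)) (≋-* g^h≋-1 g^h≋-1)
  2h≡ : h + h ≡ D * q
  2h≡ = trans (cong₂ _+_ h≡ h≡) (lemma (2 ℕ.^ e) q)
    where
    lemma : ∀ x q → x * q + x * q ≡ 2 * x * q
    lemma = ℕSolver.solve-∀
  -- Since D is even, g ^ D is the natural number |g| ^ D, which lies strictly between 1 and p.
  g^D≋̸1 : ¬ (g ℤ.^ D ≋ + 1 [mod p ])
  g^D≋̸1 eq = ℕ.<⇒≢ (ℕ.<-≤-trans 1<g (ℕ.≤-trans (ℕ.≤-reflexive (sym (ℕ.^-identityʳ ∣ g ∣))) (ℕ.^-monoʳ-≤ ∣ g ∣ {{ℕ.>-nonZero (ℕ.<-trans (s≤s z≤n) 1<g)}} (ℕ.m^n>0 2 (suc e)))))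
    (sym (≋-small (≋-trans (≋-reflexive (sym (even-^ g (2 ℕ.^ e)))) eq) g^D<p (ℕ.<-trans (s≤s (s≤s z≤n)) 2<p)))
  no-smaller : ∀ k → 1 ≤ k → k < h + h → ¬ (g ℤ.^ k ≋ + 1 [mod p ])
  -- The gcd d of k and 2 h stands in for the order of g, as g ^ d ≡ 1. Either q does not divide d,
  -- and then d divides D; or d = m q with m dividing D, so that d divides h or d = 2 h, and the
  -- latter exceeds k.
  no-smaller k 1≤k k<2h g^k≋1 with q ℕD.∣? gcd k (h + h)
  ... | no q∤d = g^D≋̸1 (^≋1-∣ d∣D (^≋1-gcd (gcd-GCD k (h + h)) g^k≋1 g^2h≋1))
    where
    d∣D : gcd k (h + h) ℕ∣ D
    d∣D = coprime-divisor (Coprimality.sym (prime-coprime q-prime q∤d))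
      (subst (gcd k (h + h) ℕ∣_) (trans 2h≡ (ℕ.*-comm D q)) (gcd[m,n]∣n k (h + h)))
  ... | yes (ℕdivides m d≡mq) = [ d∣h , d≡2h ]′ (∣2^suc e (ℕD.*-cancelʳ-∣ q {{prime⇒nonZero q-prime}} (subst (m * q ℕ∣_) 2h≡ (subst (_ℕ∣ h + h) d≡mq (gcd[m,n]∣n k (h + h))))))
    where
    d∣h : ¬ (m ℕ∣ 2 ℕ.^ e)
    d∣h m∣ = g^h≋̸1 (^≋1-∣ (subst (gcd k (h + h) ℕ∣_) (sym h≡) (subst (_ℕ∣ 2 ℕ.^ e * q) (sym d≡mq) (ℕD.*-monoˡ-∣ q m∣)))
                          (^≋1-gcd (gcd-GCD k (h + h)) g^k≋1 g^2h≋1))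
    d≡2h : ¬ (m ≡ D)
    d≡2h m≡D = ℕ.<⇒≱ k<2h (subst (_≤ k) (trans d≡mq (trans (cong (_* q) m≡D) (sym 2h≡))) (ℕD.∣⇒≤ {{ℕ.>-nonZero 1≤k}} (gcd[m,n]∣m k (h + h))))

-- Admissibility of the 2 N linear forms, and the prime tuples

infix 4 _≋?_[mod_]

_≋?_[mod_] : ∀ a b m → Dec (a ≋ b [mod m ])
a ≋? b [mod m ] = Dec.map′ CongMod⇒≋ ≋⇒CongMod (m ℕD.∣? ∣ a ℤ.- b ∣)

*≋0 : ∀ {m a} b → a ≋ + 0 [mod m ] → a ℤ.* b ≋ + 0 [mod m ]
*≋0 b e = ≋-trans (≋-* e (≋-refl {a = b})) (≋-reflexive (ℤ.*-zeroˡ b))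

-- Each of the k linear forms has at most one zero modulo l > k.
common-nonroot : ∀ {l} → Prime l → ∀ {k} → k < l → (a b : Fin k → ℤ) → (∀ i → ¬ (a i ≋ + 0 [mod l ])) →
                 Σ ℤ λ n → ∀ i → ¬ (a i ℤ.* n ℤ.+ b i ≋ + 0 [mod l ])
common-nonroot {l} pr {k} k<l a b a≢0 with Fin.any? {l} (λ n → Fin.all? (λ i → Dec.¬? (a i ℤ.* + toℕ n ℤ.+ b i ≋? + 0 [mod l ])))
... | yes (n , nonroot) = + toℕ n , nonroot
... | no all-roots = ⊥-elim (no-collision (Fin.pigeonhole k<l (proj₁ ∘ root)))
  where
  root : ∀ n → Σ (Fin k) λ i → a i ℤ.* + toℕ n ℤ.+ b i ≋ + 0 [mod l ]
  root n with i , ¬¬root , _ ← Fin.¬∀⟶∃¬-smallest k _ (λ i → Dec.¬? (a i ℤ.* + toℕ n ℤ.+ b i ≋? + 0 [mod l ])) (λ nonroot → all-roots (n , nonroot)) =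
    i , Dec.decidable-stable (a i ℤ.* + toℕ n ℤ.+ b i ≋? + 0 [mod l ]) ¬¬root
  unique : ∀ {x y r s} → r ≡ s → a r ℤ.* + x ℤ.+ b r ≋ + 0 [mod l ] → a s ℤ.* + y ℤ.+ b s ≋ + 0 [mod l ] → + x ≋ + y [mod l ]
  unique {x} {y} {r} refl ex ey =
    *-cancelˡ-≋ pr (a≢0 r) (-≋0⇒≋ (≋-trans (≋-reflexive (lemma (a r) (+ x) (+ y) (b r))) (≋⇒-≋0 (≋-trans ex (≋-sym ey)))))
    where
    lemma : ∀ a x y b → a ℤ.* x ℤ.- a ℤ.* y ≡ a ℤ.* x ℤ.+ b ℤ.- (a ℤ.* y ℤ.+ b)
    lemma = solve-∀
  no-collision : ¬ (∃₂ λ i j → toℕ i < toℕ j × proj₁ (root i) ≡ proj₁ (root j))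
  no-collision (i , j , i<j , same) = ℕ.<⇒≢ i<j (≋-small (unique same (proj₂ (root i)) (proj₂ (root j))) (Fin.toℕ<n i) (Fin.toℕ<n j))

-- `suc e` is the exponent of 2 in p - 1. Its power divides 16 with an even quotient, so the slope
-- of the form for q is even and its values stay odd.
class₁₆-split : ∀ a b → Σ ℕ λ e → Σ ℕ λ w → Σ ℕ λ x → (class₁₆ a b ≡ suc (2 ℕ.^ suc e * suc (2 * w))) × (16 ≡ 2 ℕ.^ suc e * (2 * x))
class₁₆-split 1ℙ 1ℙ = 0 , 0 , 4 , refl , refl
class₁₆-split 1ℙ 0ℙ = 0 , 1 , 4 , refl , refl
class₁₆-split 0ℙ 1ℙ = 1 , 0 , 2 , refl , refl
class₁₆-split 0ℙ 0ℙ = 2 , 0 , 1 , refl , refl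

-- M x + c = 1 + 2 ^ suc e (M′ x + c′): the second form supplies the prime q.
record Split {ψ b} (R : ResidueClass ψ b) : Set where
  open ResidueClass R
  field
    e M′ c′         : ℕ
    modulus≡        : modulus ≡ 2 ℕ.^ suc e * M′
    representative≡ : representative ≡ suc (2 ℕ.^ suc e * c′)
    M′≋0            : + M′ ≋ + 0 [mod 2 ]
    c′≋1            : + c′ ≋ + 1 [mod 2 ]

2*≋0 : ∀ n → + (2 * n) ≋ + 0 [mod 2 ]
2*≋0 n = ≋-trans (≋-reflexive (ℤ.pos-* 2 n)) (*≋0 (+ n) m≋0)

split : ∀ {ψ b} (R : ResidueClass ψ b) → Split R
split {ψ} R with e , w , x , class≡ , 16≡ ← class₁₆-split (ψ 0) (ψ 2) | ℕdivides M₁₆ modulus≡ ← ResidueClass.16∣modulus R = record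
  { e = e
  ; M′ = 2 * (x * M₁₆)
  ; c′ = suc (2 * (w + x * u))
  ; modulus≡ = trans modulus≡ (trans (cong (M₁₆ *_) 16≡) (lemma (2 ℕ.^ suc e) x M₁₆))
  ; representative≡ = begin
      representative                                           ≡⟨ m≡m%n+[m/n]*n representative 16 ⟩
      representative % 16 + u * 16                             ≡⟨ cong₂ (λ r s → r + u * s) (trans (≋-small (≋-trans (≋-sym (≋-% representative 16)) class) (m%n<n representative 16) (class₁₆<16 (ψ 0) (ψ 2))) class≡) 16≡ ⟩
      suc (2 ℕ.^ suc e * suc (2 * w) + u * (2 ℕ.^ suc e * (2 * x))) ≡⟨ cong suc (lemma′ (2 ℕ.^ suc e) w u x) ⟩
      suc (2 ℕ.^ suc e * suc (2 * (w + x * u)))                ∎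
  ; M′≋0 = 2*≋0 (x * M₁₆)
  ; c′≋1 = ≋-+ (≋-refl {a = + 1}) (2*≋0 (w + x * u))
  }
  where
  open ResidueClass R using (representative; class)
  open ≡-Reasoning
  u = representative / 16
  lemma : ∀ d x m → m * (d * (2 * x)) ≡ d * (2 * (x * m))
  lemma = ℕSolver.solve-∀
  lemma′ : ∀ d w u x → d * suc (2 * w) + u * (d * (2 * x)) ≡ d * suc (2 * (w + x * u))
  lemma′ = ℕSolver.solve-∀

module _ {N : ℕ} (1≤N : 1 ≤ N) {ψ B} (2N≤B : 2 * N ≤ B) (R : ResidueClass ψ B) (S : Split R) where
  open ResidueClass R renaming (modulus to M; representative to c)
  open Split S

  -- Index 0 is the form for p and index 1 the form for q. The shift by j ^ 2 goes into the
  -- intercept, so that all 2 N forms share the variable n.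
  slope : Fin 2 → ℕ
  slope zero    = M
  slope (suc _) = M′

  intercept : Fin 2 → ℕ → ℕ
  intercept zero    J = M * J + c
  intercept (suc _) J = M′ * J + c′

  square : Fin N → ℕ
  square j = suc (toℕ j) * suc (toℕ j)

  A′ B′ : Fin 2 × Fin N → ℤ
  A′ (t , j) = + slope t
  B′ (t , j) = + intercept t (square j)

  private
    M>0 : 0 < M
    M>0 = modulus>0

    M′>0 : 0 < M′
    M′>0 = ℕ.n≢0⇒n>0 λ M′≡0 → ℕ.<⇒≢ M>0 (sym (trans modulus≡ (trans (cong (2 ℕ.^ suc e *_) M′≡0) (ℕ.*-zeroʳ (2 ℕ.^ suc e)))))

    2≤B : 2 ≤ B
    2≤B = ℕ.≤-trans (ℕ.*-monoʳ-≤ 2 1≤N) 2N≤B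

    M≋ : ∀ {l} → + M ≋ + (2 ℕ.^ suc e) ℤ.* + M′ [mod l ]
    M≋ = ≋-reflexive (trans (cong +_ modulus≡) (ℤ.pos-* (2 ℕ.^ suc e) M′))

    c≋ : ∀ {l} → + c ≋ + 1 ℤ.+ + (2 ℕ.^ suc e) ℤ.* + c′ [mod l ]
    c≋ = ≋-reflexive (trans (cong +_ representative≡) (cong (λ z → + 1 ℤ.+ z) (ℤ.pos-* (2 ℕ.^ suc e) c′)))

    -- Modulo a prime dividing both slopes the forms are constant, with values c and c′, so n = 0
    -- serves as well as any other. This covers 2 and all primes up to B.
    nonroot-0 : ∀ {l} → + M ≋ + 0 [mod l ] → + M′ ≋ + 0 [mod l ] → ¬ (+ c ≋ + 0 [mod l ]) → ¬ (+ c′ ≋ + 0 [mod l ]) →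
                ∀ i → ¬ (A′ i ℤ.* + 0 ℤ.+ B′ i ≋ + 0 [mod l ])
    nonroot-0 {l} M≋0 M′≋0 c≢0 c′≢0 = λ { (zero , j) → c≢0 ∘ ≋-trans (≋-sym (value {M} {square j} {c} M≋0)) ; (suc zero , j) → c′≢0 ∘ ≋-trans (≋-sym (value {M′} {square j} {c′} M′≋0)) }
      where
      value : ∀ {m J c} → + m ≋ + 0 [mod l ] → + m ℤ.* + 0 ℤ.+ + (m * J + c) ≋ + c [mod l ]
      value {m} {J} {c} m≋0 = ≋-trans (≋-+ (≋-reflexive (ℤ.*-zeroʳ (+ m))) (≋-+ {a = + (m * J)} {c = + c} (≋-trans (≋-reflexive (ℤ.pos-* m J)) (*≋0 (+ J) m≋0)) ≋-refl))
        (≋-reflexive (trans (ℤ.+-identityˡ _) (ℤ.+-identityˡ (+ c))))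

    -- From c = 1 + 2 ^ suc e c′. Through it the clause c ≢ 1 of `LocalCondition` keeps q prime to
    -- l.
    c≡1⇒ : ∀ {l} → + c′ ≋ + 0 [mod l ] → + c ≋ + 1 [mod l ]
    c≡1⇒ c′≋0 = ≋-trans c≋ (≋-+ (≋-refl {a = + 1}) (≋-trans (≋-reflexive (ℤ.*-comm (+ (2 ℕ.^ suc e)) (+ c′))) (*≋0 (+ (2 ℕ.^ suc e)) c′≋0)))

    M′≋0⇒M≋0 : ∀ {l} → + M′ ≋ + 0 [mod l ] → + M ≋ + 0 [mod l ]
    M′≋0⇒M≋0 M′≋0 = ≋-trans M≋ (≋-trans (≋-reflexive (ℤ.*-comm (+ (2 ℕ.^ suc e)) (+ M′))) (*≋0 (+ (2 ℕ.^ suc e)) M′≋0))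

    nonroot-2 : ∀ i → ¬ (A′ i ℤ.* + 0 ℤ.+ B′ i ≋ + 0 [mod 2 ])
    nonroot-2 = nonroot-0 (M′≋0⇒M≋0 M′≋0) M′≋0
      (λ c≋0 → 1≋̸0 prime[2] (≋-trans (≋-sym (≋-trans c≋ (≋-+ (≋-refl {a = + 1}) (*≋0 (+ c′) (2*≋0 (2 ℕ.^ e)))))) c≋0))
      (λ c′≋0 → 1≋̸0 prime[2] (≋-trans (≋-sym c′≋1) c′≋0))

    nonroot-small : ∀ {l} → Prime l → l ≢ 2 → l ≤ B → ∀ i → ¬ (A′ i ℤ.* + 0 ℤ.+ B′ i ≋ + 0 [mod l ])
    nonroot-small {l} pr l≢2 l≤B = nonroot-0 M≋0 l∣M′ (proj₁ (local pr l≢2 l≤B)) (λ c′≋0 → proj₁ (proj₂ (local pr l≢2 l≤B)) (c≡1⇒ c′≋0))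
      where
      M≋0 : + M ≋ + 0 [mod l ]
      M≋0 = ∣⇒≋0 {a = + M} (prime∣ pr l≢2 l≤B)
      D≢0 : ¬ (+ (2 ℕ.^ suc e) ≋ + 0 [mod l ])
      D≢0 D≋0 = l≢2 (∣2^⇒≡2 (suc e) pr (≋0⇒∣ D≋0))
      l∣M′ : + M′ ≋ + 0 [mod l ]
      l∣M′ = [ (λ D≋0 → contradiction D≋0 D≢0) , id ]′ (prime-∣* pr (≋-trans (≋-sym M≋) M≋0))

    nonroot-large : ∀ {l} → Prime l → B < l → Σ ℤ λ n → ∀ i → ¬ (A′ i ℤ.* n ℤ.+ B′ i ≋ + 0 [mod l ])
    nonroot-large {l} pr B<l = proj₁ solution , λ (t , j) →
      subst (λ i → ¬ (A′ i ℤ.* proj₁ solution ℤ.+ B′ i ≋ + 0 [mod l ])) (Fin.remQuot-combine t j) (proj₂ solution (Fin.combine t j))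
      where
      l∤M : ¬ (l ℕ∣ M)
      l∤M l∣M = [ (λ l≡2 → ℕ.<⇒≱ B<l (subst (_≤ B) (sym l≡2) 2≤B)) , ℕ.<⇒≱ B<l ]′ (prime∣⇒≤ pr l∣M)
      slope≢0 : ∀ i → ¬ (A′ i ≋ + 0 [mod l ])
      slope≢0 (zero     , j) M≋0 = l∤M (≋0⇒∣ M≋0)
      slope≢0 (suc zero , j) M′≋0 = l∤M (≋0⇒∣ (M′≋0⇒M≋0 M′≋0))
      solution = common-nonroot pr {2 * N} (ℕ.≤-<-trans 2N≤B B<l) (A′ ∘ Fin.remQuot N) (B′ ∘ Fin.remQuot N) (slope≢0 ∘ Fin.remQuot N)

    nonroot : ∀ l → Prime l → Σ ℤ λ n → ∀ i → ¬ (A′ i ℤ.* n ℤ.+ B′ i ≋ + 0 [mod l ])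
    nonroot l pr with l ℕ.≟ 2 | l ℕ.≤? B
    ... | yes refl | _       = + 0 , nonroot-2
    ... | no l≢2   | yes l≤B = + 0 , nonroot-small pr l≢2 l≤B
    ... | no _     | no l≰B  = nonroot-large pr (ℕ.≰⇒> l≰B)

    locally-solvable : ∀ l → Prime l → Σ ℤ λ n → ¬ ((+ l) ∣ ∏ℤ (2 * N) (λ i → A′ (Fin.remQuot N i) ℤ.* n ℤ.+ B′ (Fin.remQuot N i)))
    locally-solvable l pr with n , n-nonroot ← nonroot l pr = n , λ l∣∏ →
      ∏≋̸0 pr _ (n-nonroot ∘ Fin.remQuot N) (≋-trans (≋-reflexive (sym (∏ℤ≡∏ (2 * N) _))) (∣⇒≋0 {a = ∏ℤ (2 * N) (λ i → A′ (Fin.remQuot N i) ℤ.* n ℤ.+ B′ (Fin.remQuot N i))} l∣∏))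

  +-*+ : ∀ m x J c → + m ℤ.* + x ℤ.+ + (m * J + c) ≡ + (m * (x + J) + c)
  +-*+ m x J c = trans (cong (ℤ._+ + (m * J + c)) (sym (ℤ.pos-* m x))) (cong +_ (lemma m x J c))
    where
    lemma : ∀ m x J c → m * x + (m * J + c) ≡ m * (x + J) + c
    lemma = ℕSolver.solve-∀

  -- `TC` bounds only the absolute value of n from below. For negative n with |n| above the
  -- intercept the form is negative; `prime-tuple` therefore adds `intercept zero 1`, the intercept
  -- of the form for p at j = 1, to its bound.
  not-positive : ∀ {m x d} → 0 < m → d < suc x → ∀ q → + m ℤ.* -[1+ x ] ℤ.+ + d ≢ + q
  not-positive {m} {x} {d} 0<m d<x q eq = ℕ.<⇒≱ d<x (ℕ.≤-trans (ℕ.m≤n*m (suc x) m {{ℕ.>-nonZero 0<m}})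
    (ℕ.≤-trans (ℕ.m≤m+n (m * suc x) q) (ℕ.≤-reflexive (ℤ.+-injective (begin
      + (m * suc x) ℤ.+ + q                                               ≡⟨ cong₂ ℤ._+_ (ℤ.pos-* m (suc x)) (sym eq) ⟩
      + m ℤ.* + suc x ℤ.+ (+ m ℤ.* ℤ.- + suc x ℤ.+ + d)                   ≡⟨ lemma (+ m) (+ suc x) (+ d) ⟩
      + d                                                                 ∎)))))
    where
    open ≡-Reasoning
    lemma : ∀ m x d → m ℤ.* x ℤ.+ (m ℤ.* (ℤ.- x) ℤ.+ d) ≡ d
    lemma = solve-∀

  prime-tuple : TC (2 * N) → ∀ bound → Σ ℕ λ n → (bound < n) ×
    (∀ j → Prime (M * (n + square j) + c) × Prime (M′ * (n + square j) + c′))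
  prime-tuple tc bound
    with tc (A′ ∘ Fin.remQuot N) (B′ ∘ Fin.remQuot N) (positive ∘ Fin.remQuot N) locally-solvable (bound + intercept zero 1)
    where
    positive : ∀ i → ℤ.0ℤ ℤ.< A′ i
    positive (zero     , j) = ℤ.+<+ M>0
    positive (suc zero , j) = ℤ.+<+ M′>0
  ... | n , large , primes = go n large (λ i → subst (λ i → IsPrimeℤ (A′ i ℤ.* n ℤ.+ B′ i)) (Fin.remQuot-combine (proj₁ i) (proj₂ i)) (primes (Fin.combine (proj₁ i) (proj₂ i))))
    where
    go : ∀ n → bound + intercept zero 1 < ∣ n ∣ → (∀ i → IsPrimeℤ (A′ i ℤ.* n ℤ.+ B′ i)) →
         Σ ℕ λ n → (bound < n) × (∀ j → Prime (M * (n + square j) + c) × Prime (M′ * (n + square j) + c′))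
    go (+ n) large primes = n , ℕ.≤-<-trans (ℕ.m≤m+n bound _) large , λ j →
      natural M c (square j) (primes (zero , j)) , natural M′ c′ (square j) (primes (suc zero , j))
      where
      natural : ∀ m c J → IsPrimeℤ (+ m ℤ.* + n ℤ.+ + (m * J + c)) → Prime (m * (n + J) + c)
      natural m c J (q , eq , pr) = subst Prime (sym (ℤ.+-injective (trans (sym (+-*+ m n J c)) eq))) pr
    go -[1+ n ] large primes with q , eq , _ ← primes (zero , fromℕ< 1≤N) = contradiction eq
      (not-positive {M} {n} M>0 (subst (λ k → intercept zero (suc k * suc k) < suc n) (sym (Fin.toℕ-fromℕ< 1≤N)) (ℕ.≤-<-trans (ℕ.m≤n+m (intercept zero 1) bound) large)) q)

-- From the prime tuples to common primitive roots

≤-∑ℕ : ∀ k (f : Fin k → ℕ) i → f i ≤ ∑ℕ k f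
≤-∑ℕ (suc k) f zero    = ℕ.m≤m+n (f zero) _
≤-∑ℕ (suc k) f (suc i) = ℕ.≤-trans (≤-∑ℕ k (f ∘ suc) i) (ℕ.m≤n+m _ (f zero))

-- The residue class reads the character at 0, at 2 and at primes given as natural numbers; beyond
-- the index range the default is 0ℙ.
extend : ∀ {n} → (Fin n → Parity) → ℕ → Parity
extend {n} φ k with k ℕ.<? n
... | yes k<n = φ (fromℕ< k<n)
... | no  _   = 0ℙ

extend-toℕ : ∀ {n} (φ : Fin n → Parity) k → extend φ (toℕ k) ≡ φ k
extend-toℕ {n} φ k with toℕ k ℕ.<? n
... | yes k<n = cong φ (Fin.fromℕ<-toℕ k k<n)
... | no  k≮n = contradiction (Fin.toℕ<n k) k≮n

1<∣_∣ : ∀ g → g ≢ -[1+ 0 ] × g ≢ + 0 × g ≢ + 1 → 1 < ∣ g ∣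
1<∣ + 0 ∣            (_ , g≢0 , _)  = contradiction refl g≢0
1<∣ + 1 ∣            (_ , _ , g≢1)  = contradiction refl g≢1
1<∣ + suc (suc n) ∣  _              = s≤s (s≤s z≤n)
1<∣ -[1+ 0 ] ∣       (g≢-1 , _ , _) = contradiction refl g≢-1
1<∣ -[1+ suc n ] ∣   _              = s≤s (s≤s z≤n)

module _ {B g} (R : SquareTimesMonomial B g) (φ : Fin (suc B) → Parity)
         (odd-value : ∑ℙ.sum (λ k → parity (SquareTimesMonomial.exponent R k) ℙ.* φ k) ≡ 1ℙ)
         (C : ResidueClass (extend φ) B) (S : Split C) where
  open ResidueClass C renaming (modulus to M; representative to c)
  open Split S

  primitive-root-in-class : ∀ {x} → 1 < ∣ g ∣ → ∣ g ∣ ≤ B → B < x → ∣ g ∣ ℕ.^ (2 ℕ.^ suc e) < x →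
    Prime (M * x + c) → Prime (M′ * x + c′) → IsPrimitiveRoot g (M * x + c)
  primitive-root-in-class {x} 1<g g≤B B<x g^D<x p-prime q-prime =
    subst (IsPrimitiveRoot g) (sym p≡) (primitive-root {e} pr q-prime refl 1<g (ℕ.<-≤-trans g^D<x x≤p) g^h≋-1)
    where
    q = M′ * x + c′
    h = 2 ℕ.^ e * q
    p = suc (h + h)
    p≡ : M * x + c ≡ p
    p≡ = trans (cong₂ (λ m c → m * x + c) modulus≡ representative≡) (lemma (2 ℕ.^ e) M′ c′ x)
      where
      lemma : ∀ d m c x → 2 * d * m * x + suc (2 * d * c) ≡ suc (d * (m * x + c) + d * (m * x + c))
      lemma = ℕSolver.solve-∀
    pr : Prime p
    pr = subst Prime p≡ p-prime
    x≤p : x ≤ p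
    x≤p = ℕ.≤-trans (ℕ.m≤n*m x M {{ℕ.>-nonZero modulus>0}}) (ℕ.≤-trans (ℕ.m≤m+n (M * x) c) (ℕ.≤-reflexive p≡))
    B<p : B < p
    B<p = ℕ.<-≤-trans B<x x≤p
    p≋c : + p ≋ + c [mod M ]
    p≋c = congruent (+ x) (trans (cong +_ (trans (sym p≡) (trans (ℕ.+-comm (M * x) c) (cong (λ z → c + z) (ℕ.*-comm M x))))) (cong (λ z → + c ℤ.+ z) (ℤ.pos-* x M)))
    g≢0 : ¬ (g ≋ + 0 [mod p ])
    g≢0 g≋0 = ℕ.<⇒≱ B<p (ℕ.≤-trans (ℕD.∣⇒≤ {{ℕ.>-nonZero (ℕ.<-trans (s≤s z≤n) 1<g)}} (≋0⇒∣ g≋0)) g≤B)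
    parities = class₁₆-parities (extend φ 0) (extend φ 2) h (≋-trans (≋-∣ 16∣modulus p≋c) class)
    values : ∀ k → k ≤ B → Admissible k → generator k ℤ.^ h ≋ sgn (extend φ k) [mod p ]
    values = generator-values (extend φ) h pr B<p (proj₁ parities) (proj₂ parities)
      λ l l-prime l≢2 l≤B → localCondition-cong {extend φ} (≋-∣ (prime∣ l-prime l≢2 l≤B) p≋c) (local l-prime l≢2 l≤B)
    g^h≋-1 : g ℤ.^ h ≋ -[1+ 0 ] [mod p ]
    g^h≋-1 = ≋-trans
      (square-times-monomial-^ R φ h pr g≢0 λ k adm →
        ≋-trans (values (toℕ k) (ℕ.≤-pred (Fin.toℕ<n k)) adm) (≋-reflexive (cong sgn (extend-toℕ φ k))))
      (≋-reflexive (cong sgn odd-value))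

theorem3 : (N : ℕ) → 1 ℕ.≤ N → TC (2 ℕ.* N) →
    (s : ℕ) → 1 ℕ.≤ s → (g : Fin s → ℤ) →
    (∀ i → g i ≢ -[1+ 0 ] × g i ≢ + 0 × g i ≢ + 1) →
    (∀ (e : Fin s → Fin 2) → ∑ℕ s (λ i → toℕ (e i)) ℕ.% 2 ≡ 1 →
    ¬ IsSquare (∏ℤ s (λ i → g i ℤ.^ toℕ (e i)))) →
    (∀ i → ∀ D → IsDiscOfQSqrt (g i) D → ¬ ((+ 3) ∣ D)) →
    Σ ℤ λ A → Σ ℤ λ C →
    ∀ (j : ℕ) → 1 ℕ.≤ j → j ℕ.≤ N →
    IsPrimeℤ (A ℤ.* (+ j) ℤ.^ 2 ℤ.+ C) ×
    (∀ i → IsPrimitiveRoot (g i) ∣ A ℤ.* (+ j) ℤ.^ 2 ℤ.+ C ∣)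
-- M j ^ 2 + (M n + c) = M (n + j ^ 2) + c is the form for p at j.
theorem3 N 1≤N tc s 1≤s g nontrivial not-square disc = + M , + (M * n + c) , conclusion
  where
  B : ℕ
  -- The summand 2 N makes every prime above B exceed the number of forms; the sum of the |g i|
  -- bounds the prime factors of each `g i`.
  B = 2 * N + ∑ℕ s (λ i → ∣ g i ∣)
  g≤B : ∀ i → ∣ g i ∣ ≤ B
  g≤B i = ℕ.≤-trans (≤-∑ℕ s (λ i → ∣ g i ∣) i) (ℕ.m≤n+m _ (2 * N))
  factored : ∀ i → SquareTimesMonomial B (g i)
  factored i = square-times-monomial (g i) (proj₁ (proj₂ (nontrivial i))) (g≤B i) (disc i)
  character = nonresidue-character g factored not-square
  φ = proj₁ character
  classes = residueClass (extend φ) B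
  splitting = split classes
  open ResidueClass classes using () renaming (modulus to M; representative to c)
  open Split splitting using (e; M′; c′)
  power : Fin s → ℕ
  power i = ∣ g i ∣ ℕ.^ (2 ℕ.^ suc e)
  -- The exponent 2 ^ suc e depends only on the residue class, so the powers of all |g i| are known
  -- before n is chosen and can enter its lower bound.
  tuple = prime-tuple 1≤N (ℕ.m≤m+n (2 * N) _) classes splitting tc (B + ∑ℕ s power)
  n = proj₁ tuple
  large = proj₁ (proj₂ tuple)
  primes = proj₂ (proj₂ tuple)
  square≡ : ∀ {j} (j<N : j < N) → square 1≤N (ℕ.m≤m+n (2 * N) _) classes splitting (fromℕ< j<N) ≡ suc j * suc j
  square≡ j<N = cong (λ k → suc k * suc k) (Fin.toℕ-fromℕ< j<N)
  value : ∀ j → + M ℤ.* (+ j) ℤ.^ 2 ℤ.+ + (M * n + c) ≡ + (M * (n + j * j) + c)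
  value j = begin
    + M ℤ.* (+ j ℤ.* (+ j ℤ.* + 1)) ℤ.+ + (M * n + c) ≡⟨ cong (λ z → + M ℤ.* (+ j ℤ.* z) ℤ.+ + (M * n + c)) (ℤ.*-identityʳ (+ j)) ⟩
    + M ℤ.* (+ j ℤ.* + j) ℤ.+ + (M * n + c)           ≡⟨ cong (λ z → + M ℤ.* z ℤ.+ + (M * n + c)) (sym (ℤ.pos-* j j)) ⟩
    + M ℤ.* + (j * j) ℤ.+ + (M * n + c)               ≡⟨ cong (λ z → z ℤ.+ + (M * n + c)) (sym (ℤ.pos-* M (j * j))) ⟩
    + (M * (j * j) + (M * n + c))                     ≡⟨ cong +_ (lemma M (j * j) n c) ⟩
    + (M * (n + j * j) + c)                           ∎
    where
    open ≡-Reasoning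
    lemma : ∀ M J n c → M * J + (M * n + c) ≡ M * (n + J) + c
    lemma = ℕSolver.solve-∀
  conclusion : ∀ j → 1 ≤ j → j ≤ N → IsPrimeℤ (+ M ℤ.* (+ j) ℤ.^ 2 ℤ.+ + (M * n + c)) ×
    (∀ i → IsPrimitiveRoot (g i) ∣ + M ℤ.* (+ j) ℤ.^ 2 ℤ.+ + (M * n + c) ∣)
  conclusion (suc j) _ j<N = (M * x + c , value (suc j) , p-prime) , λ i →
    subst (IsPrimitiveRoot (g i)) (sym (cong ∣_∣ (value (suc j))))
      (primitive-root-in-class (factored i) φ (proj₂ character i) classes splitting {x}
        (1<∣ g i ∣ (nontrivial i)) (g≤B i) (ℕ.≤-<-trans (ℕ.m≤m+n B _) bound<x)
        (ℕ.≤-<-trans (ℕ.≤-trans (≤-∑ℕ s power i) (ℕ.m≤n+m _ B)) bound<x) p-prime q-prime)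
    where
    x = n + suc j * suc j
    bound<x : B + ∑ℕ s power < x
    bound<x = ℕ.<-≤-trans large (ℕ.m≤m+n n _)
    p-prime : Prime (M * x + c)
    p-prime = subst (λ J → Prime (M * (n + J) + c)) (square≡ j<N) (proj₁ (primes (fromℕ< j<N)))
    q-prime : Prime (M′ * x + c′)
    q-prime = subst (λ J → Prime (M′ * (n + J) + c′)) (square≡ j<N) (proj₂ (primes (fromℕ< j<N)))
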